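{- Let $m>n>2$ be integers with $mn$ even. Let $f_{\max}(m,n)$ denote the maximum number of turns over all Hamilton cycles of the grid graph $G(m,n)$, and let $g(m,n)=2\left\lfloor \frac{2m+n+2}{6}\right\rfloor$. Then $$f_{\max}(m,n) = \begin{cases}mn - n & \text{if } n \equiv 0 \pmod 4, \\ mn - m & \text{if } n \equiv 1 \text{ or } 3 \pmod 4, \\ \text{either } mn-g(m,n) \text{ or } mn-g(m,n)-2 & \text{if } n \equiv 2 \pmod 4.\end{cases}$$
   Context: The grid $G(m,n)$ is the graph with vertex set $\{1,\dots,m\}\times\{1,\dots,n\}$ (vertices are called cells), where $(a,b)$ and $(c,d)$ are adjacent iff $|a-c|+|b-d|=1$. A Hamilton cycle is a cycle through every cell. For a cycle, a turn is a cell of the cycle at which the cycle turns $90$ degrees, i.e. one of its two incident cycle edges is horizontal (joins cells with equal second coordinate) and the other is vertical (joins cells with equal first coordinate). -}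

module Defs where

open import Data.Nat using (ℕ; zero; suc; _+_; _*_; _∸_; _≤_; _<_; _<?_; ∣_-_∣)
open import Data.Fin using (Fin; zero; suc; toℕ; fromℕ; fromℕ<; inject₁)
open import Data.Fin.Properties using () renaming (_≟_ to _≟ᶠ_)
open import Data.Product using (Σ; _×_; _,_; proj₁; proj₂)
open import Data.Sum using (_⊎_)
open import Data.List using (List; length; filter; allFin)
open import Relation.Binary.PropositionalEquality using (_≡_)
open import Relation.Nullary using (Dec; yes; no)
open import Relation.Nullary.Decidable using (_×-dec_; _⊎-dec_)
open import Function.Definitions using (Injective; Surjective)

-- Cells of the grid G(m,n): (a , b) with a ∈ {1..m}, b ∈ {1..n} (0-based here).
Cell : ℕ → ℕ → Set
Cell m n = Fin m × Fin n

Adjacent : ∀ {m n} → Cell m n → Cell m n → Set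
Adjacent (a , b) (c , d) = ∣ toℕ a - toℕ c ∣ + ∣ toℕ b - toℕ d ∣ ≡ 1

nextF : ∀ {N} → Fin N → Fin N
nextF {suc k} i with suc (toℕ i) <? suc k
... | yes p = fromℕ< p
... | no _  = zero

prevF : ∀ {N} → Fin N → Fin N
prevF {suc k} zero    = fromℕ k
prevF {suc k} (suc j) = inject₁ j

record HamCycle (m n : ℕ) : Set where
  field
    cell  : Fin (m * n) → Cell m n
    inj   : Injective _≡_ _≡_ cell
    surj  : Surjective _≡_ _≡_ cell
    adj   : ∀ i → Adjacent (cell i) (cell (nextF i))
open HamCycle public

Horizontal : ∀ {m n} → Cell m n → Cell m n → Set
Horizontal u v = proj₂ u ≡ proj₂ v

Vertical : ∀ {m n} → Cell m n → Cell m n → Set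
Vertical u v = proj₁ u ≡ proj₁ v

IsTurn : ∀ {m n} → HamCycle m n → Fin (m * n) → Set
IsTurn C i =
  (Horizontal (cell C (prevF i)) (cell C i) × Vertical (cell C i) (cell C (nextF i)))
  ⊎ (Vertical (cell C (prevF i)) (cell C i) × Horizontal (cell C i) (cell C (nextF i)))

isTurn? : ∀ {m n} (C : HamCycle m n) (i : Fin (m * n)) → Dec (IsTurn C i)
isTurn? C i =
  ((proj₂ (cell C (prevF i)) ≟ᶠ proj₂ (cell C i)) ×-dec (proj₁ (cell C i) ≟ᶠ proj₁ (cell C (nextF i))))
  ⊎-dec ((proj₁ (cell C (prevF i)) ≟ᶠ proj₁ (cell C i)) ×-dec (proj₂ (cell C i) ≟ᶠ proj₂ (cell C (nextF i))))

turns : ∀ {m n} → HamCycle m n → ℕ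
turns {m} {n} C = length (filter (isTurn? C) (allFin (m * n)))

IsMaxTurns : ℕ → ℕ → ℕ → Set
IsMaxTurns m n k = (Σ (HamCycle m n) λ C → turns C ≡ k) × (∀ (C : HamCycle m n) → turns C ≤ k)

{-# OPTIONS --safe #-}

-- Call a cell straight if it is not a turn. In a column the parity of the number of straight cells is that of
-- n, so for odd n every column has one. For n = 2q let h be the number of cycle edges between two adjacent
-- columns: it is even, its values on the two sides of a column add up to n with an error of at most the number
-- of straight cells of the column, and it is at most q between two columns without straight cells, since
-- the vertical edges of such columns are forced and the cycle contains no unit square. Since h = 0 at both ends
-- of the grid, this forces n straight cells when n < m. For odd q, where h = q is impossible, no three
-- consecutive columns are without straight cells, and a count near the two ends improves this to
-- (2m + n − 2) / 3 straight cells.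
--
-- Optimal cycles are spirals. Two parallel square waves, together of width four, wind around a
-- small rectangle; they contain straight cells only in the corners, two in each, so that passing from an m × n
-- to an (m + 4) × (n + 4) grid costs four straight cells.
module Submission where

open import Defs
open import Data.Bool using (Bool; true; false; not; _xor_)
open import Data.Bool.Properties using (not-involutive; xor-assoc)
open import Data.Empty using (⊥; ⊥-elim)
open import Data.Fin using (Fin; zero; suc; toℕ; fromℕ; fromℕ<; punchOut; remQuot; combine)
open import Data.Fin.Properties using (toℕ-fromℕ<; toℕ-injective; toℕ<n; toℕ-fromℕ; toℕ-inject₁; injective⇒≤; punchOut-injective; combine-remQuot; remQuot-combine; any?) renaming (_≟_ to _≟ᶠ_; all? to allFin?)
open import Data.List using (List; []; _∷_; _++_; length; map; reverse; take; drop; filter; allFin; tabulate; cartesianProduct)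
open import Data.List.Properties using (length-++; length-map; map-++; map-∘; map-tabulate; map-cong; ++-assoc; take++drop≡id; filter-≐; ≡-dec)
open import Data.List.Membership.Propositional using (_∈_)
open import Data.List.Membership.Propositional.Properties using (∈-++⁺ˡ; ∈-++⁺ʳ; ∈-++⁻; ∈-map⁺; ∈-map⁻; ∈-allFin; ∈-cartesianProduct⁺)
open import Data.List.Membership.Propositional.Properties.WithK using (unique∧set⇒bag)
open import Data.List.Relation.Binary.BagAndSetEquality using (∼bag⇒↭)
open import Data.List.Relation.Binary.Permutation.Propositional using (_↭_)
open import Data.List.Relation.Binary.Permutation.Propositional.Properties using () renaming (map⁺ to ↭-map⁺)
open import Data.List.Relation.Unary.All using (All; all?) renaming (lookup to All-lookup)
open import Data.List.Relation.Unary.Any using (here; there)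
open import Data.List.Relation.Unary.Linked using (Linked; []; [-]; _∷_; linked?)
open import Data.List.Relation.Unary.Unique.Propositional.Properties using (allFin⁺; cartesianProduct⁺) renaming (map⁺ to unique-map⁺)
open import Data.Nat using (ℕ; zero; suc; pred; _+_; _*_; _∸_; _≤_; _<_; z≤n; s≤s; ∣_-_∣; _≟_; _≤?_; _<?_; _%_; _/_)
open import Data.Nat.Properties
open import Data.Nat.DivMod using (m≡m%n+[m/n]*n; m%n<n; +-distrib-/-∣ˡ; m*n/n≡m; m<n*o⇒m/o<n)
open import Data.Nat.Divisibility using (_∣_; divides; _∣0; ∣m∣n⇒∣m+n; ∣m+n∣m⇒∣n; n∣m*n; m∣m*n; ∣⇒≤)
open import Data.Nat.ListAction using (sum)
open import Data.Nat.ListAction.Properties using (sum-++; sum-↭)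
open import Data.Nat.Primality using (euclidsLemma; prime[2])
open import Data.Nat.Tactic.RingSolver using (solve-∀)
open import Data.Product using (Σ; ∃; _×_; _,_; proj₁; proj₂; uncurry)
open import Data.Product.Properties using () renaming (≡-dec to ×-≡-dec)
open import Data.Sum using (_⊎_; inj₁; inj₂; swap; [_,_])
open import Data.Unit using (⊤)
import Data.Vec as Vec
open import Data.Vec.Properties using (lookup∘tabulate)
open import Function using (_∘_; id; mk⇔)
open import Function.Definitions using (Injective)
open import Relation.Binary.Definitions using (tri<; tri≈; tri>)
open import Relation.Binary.PropositionalEquality using (_≡_; _≢_; refl; sym; trans; cong; cong₂; subst; subst₂; module ≡-Reasoning)
open import Relation.Nullary using (¬_; Dec; yes; no)
open import Relation.Nullary.Decidable using (_×-dec_; _⊎-dec_; True; toWitness; map′)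
open import Relation.Unary using (Decidable)

-- Two-ended lattice paths

-- Enlarging both sides by four keeps m - n and the residue of n modulo 4, and it raises n, m and
-- g(m,n) by 4 each, exactly the cost of a ring. So optimality of an innermost rectangle passes to
-- all rings around it, and what remains is to find innermost rectangles with shorter side 4, 3, 5
-- or 6 for every possible difference m - n; only m = n + 1 with n ≡ 1 (mod 4) escapes this scheme.
--
-- A square wave has a period of two rows, so the parity of the height decides whether the two
-- strands arrive in the inner or the outer cells of the strip. This is why there are two kinds of
-- ends and two corner pieces.
--
-- That h = q is impossible for odd q is a matter of parity: the degrees in a column sum to an even
-- number, so every h is even.
--
-- For n ≡ 2 (mod 4) the constructed cycles have g + 2 straight cells while the bound is g, and the
-- number of straight cells is even. The resulting alternative is settled by a finite search for a
-- cycle with mn - g turns.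

Pt : Set
Pt = ℕ × ℕ

_≟ₚ_ : (a b : Pt) → Dec (a ≡ b)
_≟ₚ_ = ×-≡-dec _≟_ _≟_

open import Data.List.Membership.DecPropositional _≟ₚ_ using (_∈?_)

Δx Δy : Pt → Pt → ℕ
Δx a b = ∣ proj₁ a - proj₁ b ∣
Δy a b = ∣ proj₂ a - proj₂ b ∣

Adj : Pt → Pt → Set
Adj a b = Δx a b + Δy a b ≡ 1

isZero : ℕ → ℕ
isZero zero    = 1
isZero (suc _) = 0

-- For two neighbours of a common cell: 1 if they lie on one line, so that the cell is not a turn.
aligned : Pt → Pt → ℕ
aligned a b = isZero (Δx a b * Δy a b)

straights : List Pt → ℕ
straights (a ∷ b ∷ c ∷ l) = aligned a c + straights (b ∷ c ∷ l)
straights (a ∷ b ∷ [])    = 0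
straights (a ∷ [])        = 0
straights []              = 0

Chain : List Pt → Set
Chain = Linked Adj

chain? : ∀ l → Dec (Chain l)
chain? = linked? (λ a b → Δx a b + Δy a b ≟ 1)

glue-chain : ∀ l {a b r} → Chain (l ++ a ∷ b ∷ []) → Chain (a ∷ b ∷ r) → Chain (l ++ a ∷ b ∷ r)
glue-chain []          _        c = c
glue-chain (x ∷ [])    (e ∷ _)  c = e ∷ c
glue-chain (x ∷ y ∷ l) (e ∷ es) c = e ∷ glue-chain (y ∷ l) es c

-- `straights` sums over windows of three consecutive cells. The two lists share exactly the cells a
-- and b, so each window of the joined list lies in exactly one of them.
glue-straights : ∀ l {a b} r → straights (l ++ a ∷ b ∷ r) ≡ straights (l ++ a ∷ b ∷ []) + straights (a ∷ b ∷ r)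
glue-straights []              r = refl
glue-straights (x ∷ []) {a} {b} r = cong (_+ straights (a ∷ b ∷ r)) (sym (+-identityʳ (aligned x b)))
glue-straights (x ∷ y ∷ []) {a} r =
  trans (cong (aligned x a +_) (glue-straights (y ∷ []) r)) (sym (+-assoc (aligned x a) _ _))
glue-straights (x ∷ y ∷ z ∷ l) r =
  trans (cong (aligned x z +_) (glue-straights (y ∷ z ∷ l) r)) (sym (+-assoc (aligned x z) _ _))

Region : Set₁
Region = Pt → Set

-- Sum and product of the coordinate distances determine adjacency and alignment and, unlike the
-- distances themselves, survive an exchange of the axes. The restriction to R is for reflections by
-- truncated subtraction, which preserve distances only within the grid.
record Isometric (R : Region) (f : Pt → Pt) : Set where
  field
    Δ-sum  : ∀ {a b} → R a → R b → Δx (f a) (f b) + Δy (f a) (f b) ≡ Δx a b + Δy a b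
    Δ-prod : ∀ {a b} → R a → R b → Δx (f a) (f b) * Δy (f a) (f b) ≡ Δx a b * Δy a b
open Isometric

map-chain : ∀ {R f} → Isometric R f → ∀ l → (∀ {c} → c ∈ l → R c) → Chain l → Chain (map f l)
map-chain i []          r c       = []
map-chain i (a ∷ [])    r c       = [-]
map-chain i (a ∷ b ∷ l) r (e ∷ c) =
  trans (Δ-sum i (r (here refl)) (r (there (here refl)))) e ∷ map-chain i (b ∷ l) (λ z → r (there z)) c

map-straights : ∀ {R f} → Isometric R f → ∀ l → (∀ {c} → c ∈ l → R c) → straights (map f l) ≡ straights l
map-straights i []              r = refl
map-straights i (a ∷ [])        r = refl
map-straights i (a ∷ b ∷ [])    r = refl
map-straights i (a ∷ b ∷ c ∷ l) r =
  cong₂ _+_ (cong isZero (Δ-prod i (r (here refl)) (r (there (there (here refl))))))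
            (map-straights i (b ∷ c ∷ l) (λ z → r (there z)))

-- The first two cells p, p₁ and the last two cells q₁, q of a path.
record Ends : Set where
  constructor ends
  field p p₁ q₁ q : Pt

-- That no cell is repeated is not recorded: when N is the number of cells of R, it follows from
-- `size` and `complete` by counting. The two end cells do not yet enter `count`.
record Open (R : Region) (N s : ℕ) (e : Ends) : Set where
  open Ends e
  field
    path     : List Pt
    front    : ∃ λ t → path ≡ p ∷ p₁ ∷ t
    back     : ∃ λ t → path ≡ t ++ q₁ ∷ q ∷ []
    chain    : Chain path
    count    : straights path ≡ s
    size     : length path ≡ N
    sound    : ∀ {c} → c ∈ path → R c
    complete : ∀ {c} → R c → c ∈ path

-- With its first two cells repeated at the end, the list has each cell of the cycle as the middle
-- of exactly one window of three.
record Closed (R : Region) (N s : ℕ) : Set where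
  field
    a b      : Pt
    tl       : List Pt
  path : List Pt
  path = a ∷ b ∷ tl
  field
    chain    : Chain (path ++ a ∷ b ∷ [])
    count    : straights (path ++ a ∷ b ∷ []) ≡ s
    size     : length path ≡ N
    sound    : ∀ {c} → c ∈ path → R c
    complete : ∀ {c} → R c → c ∈ path

-- Boxes and translations

record Box : Set where
  constructor box
  field x₀ w y₀ h : ℕ

_∈ᵇ_ : Pt → Box → Set
(x , y) ∈ᵇ box x₀ w y₀ h = x₀ ≤ x × x < w + x₀ × y₀ ≤ y × y < h + y₀

_∈ᵇ?_ : ∀ c b → Dec (c ∈ᵇ b)
(x , y) ∈ᵇ? box x₀ w y₀ h = (x₀ ≤? x) ×-dec (x <? w + x₀) ×-dec (y₀ ≤? y) ×-dec (y <? h + y₀)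

record Tiles (b : Box) (l : List Pt) : Set where
  constructor tiles
  open Box b
  field
    area   : length l ≡ w * h
    inside : All (_∈ᵇ b) l
    covers : ∀ (i : Fin w) (j : Fin h) → (toℕ i + x₀ , toℕ j + y₀) ∈ l

tiles? : ∀ b l → Dec (Tiles b l)
tiles? b@(box x₀ w y₀ h) l
  with (length l ≟ w * h) ×-dec all? (_∈ᵇ? b) l ×-dec allFin? (λ i → allFin? (λ j → (toℕ i + x₀ , toℕ j + y₀) ∈? l))
... | yes (a , i , c) = yes (tiles a i c)
... | no ¬p           = no λ { (tiles a i c) → ¬p (a , i , c) }

-- The offset is the second summand, so that a numeral in front reduces to successors and the
-- shifted ends of one piece agree definitionally with those expected by the next.
shift : Pt → Pt → Pt
shift (x , y) (i , j) = (i + x , j + y)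

shiftEnds : Pt → Ends → Ends
shiftEnds o (ends p p₁ q₁ q) = ends (shift o p) (shift o p₁) (shift o q₁) (shift o q)

shiftBox : Pt → Box → Box
shiftBox (x , y) (box x₀ w y₀ h) = box (x₀ + x) w (y₀ + y) h

Everywhere : Region
Everywhere _ = ⊤

shift-Δ : ∀ i j x → ∣ i + x - j + x ∣ ≡ ∣ i - j ∣
shift-Δ i j x rewrite +-comm i x | +-comm j x = ∣m+n-m+o∣≡∣n-o∣ x i j

shift-iso : ∀ o → Isometric Everywhere (shift o)
shift-iso (x , y) = record
  { Δ-sum  = λ {a} {b} _ _ → cong₂ _+_ (shift-Δ (proj₁ a) (proj₁ b) x) (shift-Δ (proj₂ a) (proj₂ b) y)
  ; Δ-prod = λ {a} {b} _ _ → cong₂ _*_ (shift-Δ (proj₁ a) (proj₁ b) x) (shift-Δ (proj₂ a) (proj₂ b) y) }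

shift-inside : ∀ o b {c} → c ∈ᵇ b → shift o c ∈ᵇ shiftBox o b
shift-inside (x , y) (box x₀ w y₀ h) {i , j} (p , q , r , s) =
  +-monoˡ-≤ x p , subst (i + x <_) (+-assoc w x₀ x) (+-monoˡ-< x q) ,
  +-monoˡ-≤ y r , subst (j + y <_) (+-assoc h y₀ y) (+-monoˡ-< y s)

offset : ∀ {a w x} → a ≤ x → x < w + a → ∃ λ (i : Fin w) → toℕ i + a ≡ x
offset {a} {w} {x} p q = fromℕ< lt , trans (cong (_+ a) (toℕ-fromℕ< lt)) (m∸n+n≡m p)
  where
  lt : x ∸ a < w
  lt = +-cancelʳ-< a (x ∸ a) w (subst (_< w + a) (sym (m∸n+n≡m p)) q)

tiles-sound : ∀ o {b l c} → Tiles b l → c ∈ map (shift o) l → c ∈ᵇ shiftBox o b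
tiles-sound o {b} t c∈ with ∈-map⁻ (shift o) c∈
... | _ , d∈ , refl = shift-inside o b (All-lookup (Tiles.inside t) d∈)

tiles-complete : ∀ o {b l c} → Tiles b l → c ∈ᵇ shiftBox o b → c ∈ map (shift o) l
tiles-complete (x , y) {box x₀ w y₀ h} {l} t (p , q , r , s)
  with offset {x₀ + x} {w} p q | offset {y₀ + y} {h} r s
... | i , refl | j , refl =
  subst (_∈ map (shift (x , y)) l) (cong₂ _,_ (+-assoc (toℕ i) x₀ x) (+-assoc (toℕ j) y₀ y)) (∈-map⁺ (shift (x , y)) (Tiles.covers t i j))

-- A word sends a cell to the list of cells visited after it; ◂ and ▾ are stationary at coordinate 0.
Word : Set
Word = Pt → List Pt

infix 9 ▸_ ◂_ ▴_ ▾_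
▸_ ◂_ ▴_ ▾_ : Word → Word
(▸ w) (x , y) = (suc x , y) ∷ w (suc x , y)
(◂ w) (x , y) = (pred x , y) ∷ w (pred x , y)
(▴ w) (x , y) = (x , suc y) ∷ w (x , suc y)
(▾ w) (x , y) = (x , pred y) ∷ w (x , pred y)

■ : Word
■ _ = []

-- A piece of ribbon: v continues the path backwards from p, and w continues it forwards from q.
-- The lists overlap the old path in two cells, so that the straight cells at the joints are counted.
record Piece (e e′ : Ends) (b : Box) (k : ℕ) (v w : Word) : Set where
  constructor piece
  open Ends e
  open Ends e′ renaming (p to p′; p₁ to p₁′; q₁ to q₁′; q to q′)
  F : List Pt
  F = reverse (v p)
  B : List Pt
  B = w q
  field
    front  : take 2 (F ++ p ∷ p₁ ∷ []) ≡ p′ ∷ p₁′ ∷ []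
    back   : drop (length B) (q₁ ∷ q ∷ B) ≡ q₁′ ∷ q′ ∷ []
    chainF : Chain (F ++ p ∷ p₁ ∷ [])
    chainB : Chain (q₁ ∷ q ∷ B)
    count  : straights (F ++ p ∷ p₁ ∷ []) + straights (q₁ ∷ q ∷ B) ≡ k
    cover  : Tiles b (F ++ B)

piece? : ∀ e e′ b k v w → Dec (Piece e e′ b k v w)
piece? (ends p p₁ q₁ q) (ends p′ p₁′ q₁′ q′) b k v w
  with (let F = reverse (v p); B = w q in
       ≡-dec _≟ₚ_ (take 2 (F ++ p ∷ p₁ ∷ [])) (p′ ∷ p₁′ ∷ [])
       ×-dec ≡-dec _≟ₚ_ (drop (length B) (q₁ ∷ q ∷ B)) (q₁′ ∷ q′ ∷ [])
       ×-dec chain? (F ++ p ∷ p₁ ∷ []) ×-dec chain? (q₁ ∷ q ∷ B)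
       ×-dec (straights (F ++ p ∷ p₁ ∷ []) + straights (q₁ ∷ q ∷ B) ≟ k) ×-dec tiles? b (F ++ B))
... | yes (a , b , c , d , e , f) = yes (piece a b c d e f)
... | no ¬p = no λ { (piece a b c d e f) → ¬p (a , b , c , d , e , f) }

-- Every concrete drawing is verified by evaluation: ends, adjacency, number of straight cells and
-- cover of the box are all decidable.
checked : ∀ {e e′ b k v w} → {True (piece? e e′ b k v w)} → Piece e e′ b k v w
checked {e} {e′} {b} {k} {v} {w} {t} = toWitness {a? = piece? e e′ b k v w} t

split-front : ∀ {A : Set} (l : List A) {a b} → take 2 l ≡ a ∷ b ∷ [] → ∃ λ t → l ≡ a ∷ b ∷ t
split-front (a ∷ b ∷ t) refl = t , refl

split-back : ∀ {A : Set} n (l : List A) {t} → drop n l ≡ t → l ≡ take n l ++ t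
split-back n l refl = sym (take++drop≡id n l)

_⊔ᵇ_ : Region → Box → Region
(R ⊔ᵇ b) c = R c ⊎ c ∈ᵇ b

module _ {R N s e e′ b k v w} (o : Pt) (P : Open R N s (shiftEnds o e)) (Q : Piece e e′ b k v w) where
  open Open P renaming (path to l; front to l-front; back to l-back; chain to l-chain; count to l-count; size to l-size; sound to l-sound; complete to l-complete)
  open Ends e
  open Ends e′ renaming (p to p′; p₁ to p₁′; q₁ to q₁′; q to q′)
  private
    F = Piece.F Q
    B = Piece.B Q
    σ = shift o
    F′ = map σ F
    B′ = map σ B
    new = F′ ++ l ++ B′
    X = proj₁ l-front
    Y = proj₁ l-back

    l≡front : l ≡ σ p ∷ σ p₁ ∷ X
    l≡front = proj₂ l-front
    l≡back : l ≡ Y ++ σ q₁ ∷ σ q ∷ []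
    l≡back = proj₂ l-back

    l++B : l ++ B′ ≡ Y ++ σ q₁ ∷ σ q ∷ B′
    l++B = trans (cong (_++ B′) l≡back) (++-assoc Y _ _)

    mapped-front : map σ (F ++ p ∷ p₁ ∷ []) ≡ F′ ++ σ p ∷ σ p₁ ∷ []
    mapped-front = map-++ σ F _

    everywhere : ∀ {l : List Pt} {c} → c ∈ l → Everywhere c
    everywhere _ = _

    chainF′ : Chain (F′ ++ σ p ∷ σ p₁ ∷ [])
    chainF′ = subst Chain mapped-front (map-chain (shift-iso o) _ everywhere (Piece.chainF Q))
    chainB′ : Chain (σ q₁ ∷ σ q ∷ B′)
    chainB′ = map-chain (shift-iso o) _ everywhere (Piece.chainB Q)

    chain-lB : Chain (l ++ B′)
    chain-lB = subst Chain (sym l++B) (glue-chain Y (subst Chain l≡back l-chain) chainB′)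

    count-lB : straights (l ++ B′) ≡ s + straights (q₁ ∷ q ∷ B)
    count-lB = begin
      straights (l ++ B′)                           ≡⟨ cong straights l++B ⟩
      straights (Y ++ σ q₁ ∷ σ q ∷ B′)              ≡⟨ glue-straights Y B′ ⟩
      straights (Y ++ σ q₁ ∷ σ q ∷ []) + straights (σ q₁ ∷ σ q ∷ B′)
        ≡⟨ cong₂ _+_ (trans (cong straights (sym l≡back)) l-count) (map-straights (shift-iso o) (q₁ ∷ q ∷ B) everywhere) ⟩
      s + straights (q₁ ∷ q ∷ B) ∎
      where open ≡-Reasoning

    new≡ : new ≡ F′ ++ σ p ∷ σ p₁ ∷ X ++ B′
    new≡ = cong (λ z → F′ ++ z ++ B′) l≡front

    count-new : straights new ≡ k + s
    count-new = begin
      straights new                                  ≡⟨ cong straights new≡ ⟩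
      straights (F′ ++ σ p ∷ σ p₁ ∷ X ++ B′)         ≡⟨ glue-straights F′ (X ++ B′) ⟩
      straights (F′ ++ σ p ∷ σ p₁ ∷ []) + straights (σ p ∷ σ p₁ ∷ X ++ B′)
        ≡⟨ cong₂ _+_ (trans (cong straights (sym mapped-front)) (map-straights (shift-iso o) (F ++ p ∷ p₁ ∷ []) everywhere))
                     (trans (cong (λ z → straights (z ++ B′)) (sym l≡front)) count-lB) ⟩
      straights (F ++ p ∷ p₁ ∷ []) + (s + straights (q₁ ∷ q ∷ B))   ≡⟨ rearrange (straights (F ++ p ∷ p₁ ∷ [])) s _ ⟩
      (straights (F ++ p ∷ p₁ ∷ []) + straights (q₁ ∷ q ∷ B)) + s   ≡⟨ cong (_+ s) (Piece.count Q) ⟩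
      k + s ∎
      where
      open ≡-Reasoning
      rearrange : ∀ a b c → a + (b + c) ≡ (a + c) + b
      rearrange = solve-∀

    front-new : ∃ λ t → new ≡ σ p′ ∷ σ p₁′ ∷ t
    front-new with split-front (F ++ p ∷ p₁ ∷ []) (Piece.front Q)
    ... | t , F≡ = map σ t ++ X ++ B′ , (begin
      new                                          ≡⟨ new≡ ⟩
      F′ ++ (σ p ∷ σ p₁ ∷ []) ++ X ++ B′           ≡⟨ sym (++-assoc F′ _ _) ⟩
      (F′ ++ σ p ∷ σ p₁ ∷ []) ++ X ++ B′           ≡⟨ cong (_++ X ++ B′) (trans (sym mapped-front) (cong (map σ) F≡)) ⟩
      σ p′ ∷ σ p₁′ ∷ map σ t ++ X ++ B′ ∎)
      where open ≡-Reasoning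

    back-new : ∃ λ t → new ≡ t ++ σ q₁′ ∷ σ q′ ∷ []
    back-new = F′ ++ Y ++ map σ t , (begin
      F′ ++ l ++ B′                                      ≡⟨ cong (F′ ++_) l++B ⟩
      F′ ++ Y ++ map σ (q₁ ∷ q ∷ B)
        ≡⟨ cong (λ z → F′ ++ Y ++ z) (trans (cong (map σ) (split-back (length B) (q₁ ∷ q ∷ B) (Piece.back Q))) (map-++ σ t _)) ⟩
      F′ ++ Y ++ map σ t ++ σ q₁′ ∷ σ q′ ∷ []            ≡⟨ cong (F′ ++_) (sym (++-assoc Y _ _)) ⟩
      F′ ++ (Y ++ map σ t) ++ σ q₁′ ∷ σ q′ ∷ []          ≡⟨ sym (++-assoc F′ _ _) ⟩
      (F′ ++ Y ++ map σ t) ++ σ q₁′ ∷ σ q′ ∷ [] ∎)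
      where
      open ≡-Reasoning
      t = take (length B) (q₁ ∷ q ∷ B)

    size-new : length new ≡ Box.w b * Box.h b + N
    size-new = begin
      length new                                ≡⟨ length-++ F′ ⟩
      length F′ + length (l ++ B′)              ≡⟨ cong₂ _+_ (length-map σ F) (trans (length-++ l) (cong₂ _+_ l-size (length-map σ B))) ⟩
      length F + (N + length B)                 ≡⟨ rearrange (length F) N (length B) ⟩
      (length F + length B) + N                 ≡⟨ cong (_+ N) (trans (sym (length-++ F)) (Tiles.area (Piece.cover Q))) ⟩
      Box.w b * Box.h b + N ∎
      where
      open ≡-Reasoning
      rearrange : ∀ a b c → a + (b + c) ≡ (a + c) + b
      rearrange = solve-∀

    mapped-FB : map σ (F ++ B) ≡ F′ ++ B′
    mapped-FB = map-++ σ F B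

    inPiece : ∀ {c} → c ∈ F′ ++ B′ → (R ⊔ᵇ shiftBox o b) c
    inPiece c∈ = inj₂ (tiles-sound o (Piece.cover Q) (subst (_ ∈_) (sym mapped-FB) c∈))

    sound-new : ∀ {c} → c ∈ new → (R ⊔ᵇ shiftBox o b) c
    sound-new c∈ with ∈-++⁻ F′ c∈
    ... | inj₁ c∈F = inPiece (∈-++⁺ˡ c∈F)
    ... | inj₂ c∈lB with ∈-++⁻ l c∈lB
    ...   | inj₁ c∈l = inj₁ (l-sound c∈l)
    ...   | inj₂ c∈B = inPiece (∈-++⁺ʳ F′ c∈B)

    complete-new : ∀ {c} → (R ⊔ᵇ shiftBox o b) c → c ∈ new
    complete-new (inj₁ r) = ∈-++⁺ʳ F′ (∈-++⁺ˡ (l-complete r))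
    complete-new (inj₂ i) with ∈-++⁻ F′ (subst (_ ∈_) mapped-FB (tiles-complete o (Piece.cover Q) i))
    ... | inj₁ c∈F = ∈-++⁺ˡ c∈F
    ... | inj₂ c∈B = ∈-++⁺ʳ F′ (∈-++⁺ʳ l c∈B)

  extend : Open (R ⊔ᵇ shiftBox o b) (Box.w b * Box.h b + N) (k + s) (shiftEnds o e′)
  extend = record
    { path = new ; front = front-new ; back = back-new
    ; chain = subst Chain (sym new≡) (glue-chain F′ chainF′ (subst (λ z → Chain (z ++ B′)) l≡front chain-lB))
    ; count = count-new ; size = size-new ; sound = sound-new ; complete = complete-new }

-- Joining q to p turns both end cells into middle cells. Their windows are (q₁ , q , p) and (q , p
-- , p₁), which accounts for the two additional summands.
close : ∀ {R N s e} o → Open R N s (shiftEnds o e) → let open Ends e in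
        Adj q p → Closed R N (aligned q₁ p + aligned q p₁ + s)
close {R} {N} {s} {ends p p₁ q₁ q} o P qp = record
  { a = σ p ; b = σ p₁ ; tl = X
  ; chain = subst Chain (sym (trans (cong (_++ ab) (trans (sym l≡front) l≡back)) (++-assoc Y _ _)))
      (glue-chain Y (subst Chain l≡back (Open.chain P)) (second-chain Y (subst Chain l≡back (Open.chain P))))
  ; count = begin
      straights ((σ p ∷ σ p₁ ∷ X) ++ ab)                    ≡⟨ cong (λ z → straights (z ++ ab)) (trans (sym l≡front) l≡back) ⟩
      straights ((Y ++ σ q₁ ∷ σ q ∷ []) ++ ab)              ≡⟨ cong straights (++-assoc Y _ _) ⟩
      straights (Y ++ σ q₁ ∷ σ q ∷ ab)                      ≡⟨ glue-straights Y ab ⟩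
      straights (Y ++ σ q₁ ∷ σ q ∷ []) + straights (map σ (q₁ ∷ q ∷ p ∷ p₁ ∷ []))
        ≡⟨ cong₂ _+_ (trans (cong straights (sym l≡back)) (Open.count P)) (map-straights (shift-iso o) (q₁ ∷ q ∷ p ∷ p₁ ∷ []) _) ⟩
      s + (aligned q₁ p + (aligned q p₁ + 0))               ≡⟨ rearrange s (aligned q₁ p) (aligned q p₁) ⟩
      aligned q₁ p + aligned q p₁ + s ∎
  ; size = trans (cong length (sym l≡front)) (Open.size P)
  ; sound = λ c∈ → Open.sound P (subst (_ ∈_) (sym l≡front) c∈)
  ; complete = λ r → subst (_ ∈_) l≡front (Open.complete P r) }
  where
  open ≡-Reasoning
  σ = shift o
  X = proj₁ (Open.front P)
  Y = proj₁ (Open.back P)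
  ab = σ p ∷ σ p₁ ∷ []
  l≡front = proj₂ (Open.front P)
  l≡back = proj₂ (Open.back P)
  rearrange : ∀ a b c → a + (b + (c + 0)) ≡ b + c + a
  rearrange = solve-∀
  first : ∀ {a b : Pt} {l} → Chain (a ∷ b ∷ l) → Adj a b
  first (e ∷ _) = e
  second-chain : ∀ Y → Chain (Y ++ σ q₁ ∷ σ q ∷ []) → Chain (σ q₁ ∷ σ q ∷ ab)
  second-chain []          (e ∷ _) = e ∷ trans (Δ-sum (shift-iso o) {q} {p} _ _) qp ∷ first (subst Chain l≡front (Open.chain P)) ∷ [-]
  second-chain (y ∷ [])    (_ ∷ c) = second-chain [] c
  second-chain (y ∷ z ∷ Y) (_ ∷ c) = second-chain (z ∷ Y) c

relabel : ∀ {R R′ N N′ s s′ e} → (∀ {c} → R c → R′ c) → (∀ {c} → R′ c → R c) → N ≡ N′ → s ≡ s′ → Open R N s e → Open R′ N′ s′ e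
relabel to from refl refl P = record
  { path = path ; front = front ; back = back ; chain = chain ; count = count ; size = size
  ; sound = λ c∈ → to (sound c∈) ; complete = λ r → complete (from r) }
  where open Open P

relabelᶜ : ∀ {R R′ N N′ s s′} → (∀ {c} → R c → R′ c) → (∀ {c} → R′ c → R c) → N ≡ N′ → s ≡ s′ → Closed R N s → Closed R′ N′ s′
relabelᶜ to from refl refl P = record
  { a = a ; b = b ; tl = tl ; chain = chain ; count = count ; size = size
  ; sound = λ c∈ → to (sound c∈) ; complete = λ r → complete (from r) }
  where open Closed P

-- Images of paths under isometries

record Onto (R R′ : Region) (f : Pt → Pt) : Set where
  field
    isometric : Isometric R f
    into      : ∀ {c} → R c → R′ (f c)
    onto      : ∀ {c} → R′ c → ∃ λ d → R d × f d ≡ c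

mapEnds : (Pt → Pt) → Ends → Ends
mapEnds f (ends p p₁ q₁ q) = ends (f p) (f p₁) (f q₁) (f q)

module _ {R R′ f} (i : Onto R R′ f) where
  open Onto i

  map-sound : ∀ {l} → (∀ {c} → c ∈ l → R c) → ∀ {c} → c ∈ map f l → R′ c
  map-sound s c∈ with ∈-map⁻ f c∈
  ... | _ , d∈ , refl = into (s d∈)

  map-complete : ∀ {l} → (∀ {c} → R c → c ∈ l) → ∀ {c} → R′ c → c ∈ map f l
  map-complete k r with onto r
  ... | _ , rd , refl = ∈-map⁺ f (k rd)

  mapOpen : ∀ {N s e} → Open R N s e → Open R′ N s (mapEnds f e)
  mapOpen P = record
    { path = map f path
    ; front = map f (proj₁ front) , cong (map f) (proj₂ front)
    ; back = map f (proj₁ back) , trans (cong (map f) (proj₂ back)) (map-++ f (proj₁ back) _)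
    ; chain = map-chain isometric path sound chain
    ; count = trans (map-straights isometric path sound) count
    ; size = trans (length-map f path) size
    ; sound = map-sound sound ; complete = map-complete complete }
    where open Open P

  mapClosed : ∀ {N s} → Closed R N s → Closed R′ N s
  mapClosed P = record
    { a = f a ; b = f b ; tl = map f tl
    ; chain = subst Chain m++ (map-chain isometric (path ++ a ∷ b ∷ []) sound′ chain)
    ; count = trans (cong straights (sym m++)) (trans (map-straights isometric (path ++ a ∷ b ∷ []) sound′) count)
    ; size = trans (length-map f path) size
    ; sound = map-sound sound ; complete = map-complete complete }
    where
    open Closed P
    m++ : map f (path ++ a ∷ b ∷ []) ≡ map f path ++ f a ∷ f b ∷ []
    m++ = map-++ f path _
    sound′ : ∀ {c} → c ∈ path ++ a ∷ b ∷ [] → R c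
    sound′ c∈ with ∈-++⁻ path c∈
    ... | inj₁ z                   = sound z
    ... | inj₂ (here refl)         = sound (here refl)
    ... | inj₂ (there (here refl)) = sound (there (here refl))

Rect : ℕ → ℕ → Region
Rect m n (x , y) = x < m × y < n

reflect-Δ : ∀ {M} a b → a ≤ M → b ≤ M → ∣ M ∸ a - M ∸ b ∣ ≡ ∣ a - b ∣
reflect-Δ {M}     zero    b       _       q       = trans (m≤n⇒∣n-m∣≡n∸m (m∸n≤m M b)) (m∸[m∸n]≡n q)
reflect-Δ {M}     (suc a) zero    p       _       = trans (m≤n⇒∣m-n∣≡n∸m (m∸n≤m M (suc a))) (m∸[m∸n]≡n p)
reflect-Δ {suc M} (suc a) (suc b) (s≤s p) (s≤s q) = reflect-Δ a b p q

-- A clockwise quarter turn of a grid with columns 0 to M: the top row becomes the last column, the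
-- last column the bottom row.
rotate : ℕ → Pt → Pt
rotate M (x , y) = (y , M ∸ x)

rotate-onto : ∀ M n → Onto (Rect (suc M) n) (Rect n (suc M)) (rotate M)
rotate-onto M n = record
  { isometric = record
      { Δ-sum  = λ { {x , y} {x′ , y′} (s≤s p , _) (s≤s q , _) → trans (cong (∣ y - y′ ∣ +_) (reflect-Δ x x′ p q)) (+-comm ∣ y - y′ ∣ _) }
      ; Δ-prod = λ { {x , y} {x′ , y′} (s≤s p , _) (s≤s q , _) → trans (cong (∣ y - y′ ∣ *_) (reflect-Δ x x′ p q)) (*-comm ∣ y - y′ ∣ _) } }
  ; into = λ { {x , y} (p , q) → q , s≤s (m∸n≤m M x) }
  ; onto = λ { {x , y} (p , s≤s q) → (M ∸ y , x) , (s≤s (m∸n≤m M y) , p) , cong (x ,_) (m∸[m∸n]≡n q) } }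

transpose : Pt → Pt
transpose (x , y) = (y , x)

transpose-onto : ∀ m n → Onto (Rect m n) (Rect n m) transpose
transpose-onto m n = record
  { isometric = record
      { Δ-sum  = λ { {x , y} {x′ , y′} _ _ → +-comm ∣ y - y′ ∣ ∣ x - x′ ∣ }
      ; Δ-prod = λ { {x , y} {x′ , y′} _ _ → *-comm ∣ y - y′ ∣ ∣ x - x′ ∣ } }
  ; into = λ (p , q) → q , p
  ; onto = λ { {x , y} (p , q) → (y , x) , (q , p) , refl } }

record Start (e : Ends) (b : Box) (k : ℕ) (w : Word) : Set where
  constructor start
  open Ends e
  field
    front : take 2 (p ∷ w p) ≡ p ∷ p₁ ∷ []
    back  : drop (pred (length (w p))) (p ∷ w p) ≡ q₁ ∷ q ∷ []
    chain : Chain (p ∷ w p)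
    count : straights (p ∷ w p) ≡ k
    cover : Tiles b (p ∷ w p)

start? : ∀ e b k w → Dec (Start e b k w)
start? (ends p p₁ q₁ q) b k w
  with ≡-dec _≟ₚ_ (take 2 (p ∷ w p)) (p ∷ p₁ ∷ []) ×-dec ≡-dec _≟ₚ_ (drop (pred (length (w p))) (p ∷ w p)) (q₁ ∷ q ∷ [])
       ×-dec chain? (p ∷ w p) ×-dec (straights (p ∷ w p) ≟ k) ×-dec tiles? b (p ∷ w p)
... | yes (a , b , c , d , e) = yes (start a b c d e)
... | no ¬p = no λ { (start a b c d e) → ¬p (a , b , c , d , e) }

begin-at : ∀ {e b k w} o → {True (start? e b k w)} → Open (_∈ᵇ shiftBox o b) (Box.w b * Box.h b) k (shiftEnds o e)
begin-at {e@(ends p p₁ q₁ q)} {b} {k} {w} o {t} = record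
  { path = map (shift o) l
  ; front = let r , eq = split-front l front in map (shift o) r , cong (map (shift o)) eq
  ; back = map (shift o) (take n l) , trans (cong (map (shift o)) (split-back n l back)) (map-++ (shift o) (take n l) _)
  ; chain = map-chain (shift-iso o) l _ chain
  ; count = trans (map-straights (shift-iso o) l _) count
  ; size = trans (length-map (shift o) l) (Tiles.area cover)
  ; sound = tiles-sound o cover ; complete = tiles-complete o cover }
  where
  l = p ∷ w p
  n = pred (length (w p))
  open Start (toWitness {a? = start? e b k w} t)

-- Spirals of width four

-- Both strands turn left in a 4 × 4 block, with one straight cell each.
corner-narrow : Piece (ends (0 , 1) (0 , 0) (0 , 3) (0 , 2)) (ends (4 , 3) (3 , 3) (2 , 3) (1 , 3)) (box 1 4 0 4) 2
  (▸ ▾ ▸ ▴ ▸ ▾ ▸ ▴ ▴ ◂ ▴ ▸ ■) (▸ ▸ ▴ ◂ ■)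
corner-narrow = checked

corner-wide : Piece (ends (0 , 0) (0 , 1) (0 , 2) (0 , 3)) (ends (4 , 4) (3 , 4) (2 , 4) (1 , 4)) (box 1 4 0 5) 2
  (▸ ▴ ▸ ▾ ▸ ▸ ▴ ◂ ▴ ▸ ▴ ◂ ▴ ▸ ■) (▸ ▾ ▸ ▴ ▴ ◂ ■)
corner-wide = checked

-- Both strands end in the outer cells of a row of four, having come from the inner ones; the waves
-- return to this pattern every second row.
row : Ends
row = ends (3 , 0) (2 , 0) (1 , 0) (0 , 0)

two-rows : Piece row (ends (3 , 2) (2 , 2) (1 , 2) (0 , 2)) (box 0 4 1 2) 0 (▴ ◂ ▴ ▸ ■) (▴ ▸ ▴ ◂ ■)
two-rows = checked

-- Half a period of the waves, which exchanges inner and outer cells: an odd number of remaining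
-- rows leads to `Narrow`, an even number to `Wide`.
one-row : Piece row (ends (2 , 1) (3 , 1) (0 , 1) (1 , 1)) (box 0 4 1 1) 0 (▴ ◂ ■) (▴ ▸ ■)
one-row = checked

-- Either cap costs two straight cells. Here both lie inside the piece; for `cap-two-rows` the
-- second is the last cell of the path, which becomes straight on closing.
cap-one-row : Piece row (ends (3 , 0) (2 , 0) (2 , 1) (3 , 1)) (box 0 4 1 1) 2 ■ (▴ ▸ ▸ ▸ ■)
cap-one-row = checked

cap-two-rows : Piece row (ends (3 , 0) (2 , 0) (3 , 2) (3 , 1)) (box 0 4 1 2) 1 ■ (▴ ▴ ▸ ▾ ▸ ▴ ▸ ▾ ■)
cap-two-rows = checked

Strip : ℕ → ℕ → ℕ → Region
Strip m n h c@(x , y) = Rect m n c ⊎ (m ≤ x × x < 4 + m × y < h)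

strip-grow : ∀ {m n y} h {c} → (Strip m n y ⊔ᵇ box m 4 y h) c → Strip m n (h + y) c
strip-grow         h (inj₁ (inj₁ r))           = inj₁ r
strip-grow {y = y} h (inj₁ (inj₂ (a , b , c))) = inj₂ (a , b , <-≤-trans c (m≤n+m y h))
strip-grow         h (inj₂ (a , b , _ , d))    = inj₂ (a , b , d)

strip-shrink : ∀ {m n y} h {c} → Strip m n (h + y) c → (Strip m n y ⊔ᵇ box m 4 y h) c
strip-shrink         h (inj₁ r) = inj₁ (inj₁ r)
strip-shrink {y = y} h {_ , y′} (inj₂ (a , b , c)) with y′ <? y
... | yes d = inj₁ (inj₂ (a , b , d))
... | no ¬d = inj₂ (a , b , ≮⇒≥ ¬d , c)

strip-full : ∀ {m n c} → Strip m n n c → Rect (4 + m) n c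
strip-full {m} (inj₁ (p , q))     = <-≤-trans p (m≤n+m m 4) , q
strip-full     (inj₂ (_ , p , q)) = p , q

full-strip : ∀ {m n c} → Rect (4 + m) n c → Strip m n n c
full-strip {m} {c = x , _} (p , q) with x <? m
... | yes r = inj₁ (r , q)
... | no ¬r = inj₂ (≮⇒≥ ¬r , p , q)

Leg : ℕ → ℕ → ℕ → ℕ → Set
Leg m n y s = Open (Strip m n (suc y)) (4 * suc y + m * n) s (shiftEnds (m , y) row)

narrowEnds wideEnds : Ends
narrowEnds = ends (0 , 1) (0 , 0) (0 , 3) (0 , 2)
wideEnds   = ends (0 , 0) (0 , 1) (0 , 2) (0 , 3)

-- Paths covering the first m + 1 columns whose ends lie at the bottom of the last column, in rows 1 and 2
-- (narrow) or 0 and 3 (wide).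
Narrow Wide State : ℕ → ℕ → ℕ → Set
Narrow m n s = Open (Rect (suc m) n) (suc m * n) s (shiftEnds (m , 0) narrowEnds)
Wide   m n s = Open (Rect (suc m) n) (suc m * n) s (shiftEnds (m , 0) wideEnds)
State  m n s = Narrow m n s ⊎ Wide m n s

private
  area+ : ∀ h y a → 4 * h + (4 * y + a) ≡ 4 * (h + y) + a
  area+ = solve-∀

  full-area : ∀ m n → 4 * n + m * n ≡ (4 + m) * n
  full-area = solve-∀

  turned-area : ∀ m n → 4 * n + m * n ≡ n * (4 + m)
  turned-area = solve-∀

climb-two : ∀ {m n y s} → Leg m n y s → Leg m n (2 + y) s
climb-two {m} {n} {y} P =
  relabel (strip-grow 2) (strip-shrink 2) (area+ 2 (suc y) (m * n)) refl (extend (m , y) P two-rows)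

turn : ∀ {m n y s} e e′ → mapEnds (rotate (3 + m)) (shiftEnds (m , y) e) ≡ shiftEnds (n , 0) e′ →
       Open (Strip m (suc n) (suc n)) (4 * suc n + m * suc n) s (shiftEnds (m , y) e) →
       Open (Rect (suc n) (4 + m)) (suc n * (4 + m)) s (shiftEnds (n , 0) e′)
turn {m} {n} e e′ eq P =
  subst (Open _ _ _) eq (mapOpen (rotate-onto (3 + m) (suc n)) (relabel strip-full full-strip (turned-area m (suc n)) refl P))

rotate-row : ∀ m y y₀ y₁ y₂ y₃ i j k l → 3 + m ∸ (i + m) ≡ y₀ → 3 + m ∸ (j + m) ≡ y₁ → 3 + m ∸ (k + m) ≡ y₂ → 3 + m ∸ (l + m) ≡ y₃ →
             mapEnds (rotate (3 + m)) (ends (i + m , y) (j + m , y) (k + m , y) (l + m , y)) ≡ ends (y , y₀) (y , y₁) (y , y₂) (y , y₃)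
rotate-row m y _ _ _ _ i j k l refl refl refl refl = refl

stop : ∀ {m y s} → Leg m (suc y) y s → Wide y (4 + m) s
stop {m} {y} = turn row wideEnds
  (rotate-row m y 0 1 2 3 3 2 1 0 (n∸n≡0 m) (m+n∸n≡m 1 m) (m+n∸n≡m 2 m) (m+n∸n≡m 3 m))

last-row : ∀ {m y s} → Leg m (2 + y) y s → Narrow (suc y) (4 + m) s
last-row {m} {y} P = turn (ends (2 , 1) (3 , 1) (0 , 1) (1 , 1)) narrowEnds
  (rotate-row m (suc y) 1 0 3 2 2 3 0 1 (m+n∸n≡m 1 m) (n∸n≡0 m) (m+n∸n≡m 3 m) (m+n∸n≡m 2 m))
  (relabel (strip-grow 1) (strip-shrink 1) (area+ 1 (suc y) (m * suc (suc y))) refl (extend (m , y) P one-row))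

climb : ∀ r {m n y s} → r + y ≡ n → Leg m (suc n) y s → State n (4 + m) s
climb zero          refl P = inj₂ (stop P)
climb (suc zero)    refl P = inj₁ (last-row P)
climb (suc (suc r)) {y = y} eq P =
  climb r (trans (trans (+-suc r (suc y)) (cong suc (+-suc r y))) eq) (climb-two P)

cap : ∀ r {m n y s} → suc r + y ≡ n → Leg m (suc n) y s → Closed (Rect (4 + m) (suc n)) ((4 + m) * suc n) (2 + s)
cap zero {m} {y = y} refl P = relabelᶜ (λ c → strip-full (strip-grow 1 c)) (λ c → strip-shrink 1 (full-strip c))
  (trans (area+ 1 (suc y) (m * suc (suc y))) (full-area m (suc (suc y)))) refl
  (close (m , y) (extend (m , y) P cap-one-row) refl)
cap (suc zero) {m} {y = y} refl P = relabelᶜ (λ c → strip-full (strip-grow 2 c)) (λ c → strip-shrink 2 (full-strip c))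
  (trans (area+ 2 (suc y) (m * suc (suc (suc y)))) (full-area m (suc (suc (suc y))))) refl
  (close (m , y) (extend (m , y) P cap-two-rows) refl)
cap (suc (suc r)) {y = y} eq P =
  cap r (trans (cong suc (trans (+-suc r (suc y)) (cong suc (+-suc r y)))) eq) (climb-two P)

from-corner : ∀ {m n} h {c} → (Rect (suc m) n ⊔ᵇ box (suc m) 4 0 h) c → Strip (suc m) n h c
from-corner h (inj₁ r)               = inj₁ r
from-corner h (inj₂ (a , b , _ , d)) = inj₂ (a , b , subst (_ <_) (+-identityʳ h) d)

to-corner : ∀ {m n} h {c} → Strip (suc m) n h c → (Rect (suc m) n ⊔ᵇ box (suc m) 4 0 h) c
to-corner h (inj₁ r)           = inj₁ r
to-corner h (inj₂ (a , b , d)) = inj₂ (a , b , z≤n , subst (_ <_) (sym (+-identityʳ h)) d)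

leave-narrow : ∀ {m n s} → Narrow m n s → Leg (suc m) n 3 (2 + s)
leave-narrow {m} P = relabel (from-corner 4) (to-corner 4) refl refl (extend (m , 0) P corner-narrow)

leave-wide : ∀ {m n s} → Wide m n s → Leg (suc m) n 4 (2 + s)
leave-wide {m} P = relabel (from-corner 5) (to-corner 5) refl refl (extend (m , 0) P corner-wide)

-- Adding a strip and turning clockwise makes the ends lie at the bottom of the last column again.
quarter : ∀ {m n s} → State m (5 + n) s → State (4 + n) (5 + m) (2 + s)
quarter {n = n} (inj₁ P) = climb (suc n) (+-comm (suc n) 3) (leave-narrow P)
quarter {n = n} (inj₂ P) = climb n (+-comm n 4) (leave-wide P)

quarters : ∀ k {m n s} → State m (5 + n) s → State (k * 4 + m) (5 + (k * 4 + n)) (k * 4 + s)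
quarters zero    P = P
quarters (suc k) P = quarter (quarter (quarters k P))

finish : ∀ {m n s} → State m (6 + n) s → Closed (Rect (5 + m) (6 + n)) ((5 + m) * (6 + n)) (4 + s)
finish {n = n} (inj₁ P) = cap (suc n) (+-comm (suc (suc n)) 3) (leave-narrow P)
finish {n = n} (inj₂ P) = cap n (+-comm (suc n) 4) (leave-wide P)

-- The first strip is separate because the rectangle may have only four rows: `corner-narrow` fits,
-- but `quarter` asks for the five rows of `corner-wide`. Then come 2k quarters and a capped strip.
-- The number of quarter turns is odd, so the sides m + 2 and n + 4 reappear exchanged, each
-- enlarged by 4 (k + 1).
spiral : ∀ k {m n s} → Narrow (suc m) (4 + n) s →
         Closed (Rect (5 + (k * 4 + (3 + n))) (6 + (k * 4 + m))) ((5 + (k * 4 + (3 + n))) * (6 + (k * 4 + m))) (4 + (k * 4 + (2 + s)))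
spiral k {m} {n} {s} P =
  finish (subst (λ z → State (k * 4 + (3 + n)) (5 + z) (k * 4 + (2 + s))) (+-suc (k * 4) m)
    (quarters k (climb n (+-comm n 3) (leave-narrow P))))

close-narrow : ∀ {m n s} → Narrow m n s → Closed (Rect (suc m) n) (suc m * n) (2 + s)
close-narrow {m} P = close (m , 0) P refl

-- Innermost rectangles

box⇒strip : ∀ {n} h {c} → c ∈ᵇ box 0 4 0 h → Strip 0 n h c
box⇒strip h (a , b , _ , d) = inj₂ (a , b , subst (_ <_) (+-identityʳ h) d)

strip⇒box : ∀ {n} h {c} → Strip 0 n h c → c ∈ᵇ box 0 4 0 h
strip⇒box h (inj₁ (() , _))
strip⇒box h (inj₂ (a , b , d)) = a , b , z≤n , subst (_ <_) (sym (+-identityʳ h)) d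

tower : ∀ j {n y s} → Leg 0 n y s → Leg 0 n (j * 2 + y) s
tower zero    P = P
tower (suc j) P = climb-two (tower j P)

-- The two straight cells are the inner cells of the initial row; closing will add two more.
four-even : ∀ j → Narrow (1 + (j * 2 + 0)) 4 2
four-even j = last-row (tower j (relabel (box⇒strip 1) (strip⇒box 1) refl refl (begin-at {row} {box 0 4 0 1} {w = ◂ ◂ ◂ ■} (0 , 0))))

-- Waves climb two rows at a time, so the other parity needs a different beginning: a block of four
-- rows, again with only two straight cells.
four-odd : ∀ j → Narrow (1 + (j * 2 + 3)) 4 2
four-odd j = last-row (tower j (relabel (box⇒strip 4) (strip⇒box 4) refl refl
  (begin-at {shiftEnds (0 , 3) row} {box 0 4 0 4} {w = ◂ ▾ ▸ ▾ ▾ ◂ ▴ ◂ ▾ ◂ ▴ ▴ ▸ ▴ ◂ ■} (0 , 0))))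

stack : ∀ {m y g} h {c} → ((_∈ᵇ box 0 m (g + y) h) ⊔ᵇ box 0 m y g) c → c ∈ᵇ box 0 m y (h + g)
stack {m} {y} {g} h {_ , y′} (inj₁ (p , q , r , s)) = p , q , ≤-trans (m≤n+m y g) r , subst (y′ <_) (sym (+-assoc h g y)) s
stack {m} {y} {g} h {_ , y′} (inj₂ (p , q , r , s)) = p , q , r , <-≤-trans s (+-monoˡ-≤ y (m≤n+m g h))

unstack : ∀ {m y g} h {c} → c ∈ᵇ box 0 m y (h + g) → ((_∈ᵇ box 0 m (g + y) h) ⊔ᵇ box 0 m y g) c
unstack {m} {y} {g} h {_ , y′} (p , q , r , s) with y′ <? g + y
... | yes t = inj₂ (p , q , r , t)
... | no ¬t = inj₁ (p , q , ≮⇒≥ ¬t , subst (y′ <_) (+-assoc h g y) s)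

box⇒rect : ∀ {m n c} → c ∈ᵇ box 0 m 0 n → Rect m n c
box⇒rect {m} {n} (_ , p , _ , q) = subst (_ <_) (+-identityʳ m) p , subst (_ <_) (+-identityʳ n) q

rect⇒box : ∀ {m n c} → Rect m n c → c ∈ᵇ box 0 m 0 n
rect⇒box {m} {n} (p , q) = z≤n , subst (_ <_) (sym (+-identityʳ m)) p , z≤n , subst (_ <_) (sym (+-identityʳ n)) q

from-word : ∀ {m n k} e w → {True (start? e (box 0 m 0 n) k w)} → Open (Rect m n) (m * n) k (shiftEnds (0 , 0) e)
from-word e w {t} = relabel box⇒rect rect⇒box refl refl (begin-at {e} {w = w} (0 , 0) {t})

three-rows : Piece (ends (1 , 2) (0 , 2) (2 , 3) (2 , 2)) (ends (1 , 0) (0 , 0) (2 , 1) (2 , 0)) (box 0 3 0 2) 2 (▾ ◂ ▾ ▸ ■) (▾ ▾ ■)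
three-rows = checked

three-end : Piece (ends (1 , 2) (0 , 2) (2 , 3) (2 , 2)) (ends (2 , 1) (2 , 0) (2 , 3) (2 , 2)) (box 0 3 0 2) 1 (▾ ◂ ▾ ▸ ▸ ▴ ■) ■
three-end = checked

private
  area₂ : ∀ m h → m * 2 + m * h ≡ m * (h + 2)
  area₂ = solve-∀
  area₄ : ∀ m h → m * 4 + m * h ≡ m * (h + 4)
  area₄ = solve-∀

-- The summand 2 stands on the right to match the height `h + g` in `stack` definitionally.
height : ℕ → ℕ → ℕ
height zero    h = h
height (suc k) h = height k h + 2

height≡ : ∀ k h → height k h ≡ k * 2 + h
height≡ zero    h = refl
height≡ (suc k) h = trans (+-comm (height k h) 2) (cong (2 +_) (height≡ k h))

-- The tower grows downwards, so that its ends stay in the bottom row. Two straight cells per pair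
-- of rows is optimal, since the rows have odd length and become columns after transposition.
three-tower : ∀ k y → Open (_∈ᵇ box 0 3 y (height k 2)) (3 * height k 2) (k * 2 + 1) (shiftEnds (0 , y) (ends (1 , 0) (0 , 0) (2 , 1) (2 , 0)))
three-tower zero    y = begin-at {w = ◂ ▴ ▸ ▸ ▾ ■} (0 , y)
three-tower (suc k) y = relabel (stack (height k 2)) (unstack (height k 2)) (area₂ 3 (height k 2)) refl (extend (0 , y) (three-tower k (2 + y)) three-rows)

three : ∀ k → Narrow 2 (4 + k * 2) (2 + k * 2)
three k = relabel (λ {c} r → subst (λ n → Rect 3 n c) eq (box⇒rect (stack (height k 2) r)))
                  (λ {c} r → unstack (height k 2) (rect⇒box (subst (λ n → Rect 3 n c) (sym eq) r)))
                  (trans (area₂ 3 (height k 2)) (cong (3 *_) eq)) (cong suc (+-comm (k * 2) 1))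
                  (extend (0 , 0) (three-tower k 2) three-end)
  where
  eq : height k 2 + 2 ≡ 4 + k * 2
  eq = trans (cong (_+ 2) (height≡ k 2)) (trans (+-assoc (k * 2) 2 2) (+-comm (k * 2) 4))

-- In the first repetition the strand at q arrives from above instead of from the right, and
-- continuing downwards makes q straight.
five-rows₀ : Piece (ends (1 , 2) (0 , 2) (2 , 3) (2 , 2)) (ends (1 , 0) (0 , 0) (3 , 0) (2 , 0)) (box 0 5 0 2) 3 (▾ ◂ ▾ ▸ ■) (▾ ▸ ▸ ▾ ◂ ◂ ■)
five-rows₀ = checked

five-rows : Piece (ends (1 , 2) (0 , 2) (3 , 2) (2 , 2)) (ends (1 , 0) (0 , 0) (3 , 0) (2 , 0)) (box 0 5 0 2) 2 (▾ ◂ ▾ ▸ ■) (▾ ▸ ▸ ▾ ◂ ◂ ■)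
five-rows = checked

five-end₀ : Piece (ends (1 , 4) (0 , 4) (2 , 5) (2 , 4)) (ends (4 , 1) (4 , 0) (4 , 3) (4 , 2)) (box 0 5 0 4) 3
  (▾ ◂ ▾ ▸ ▾ ◂ ▾ ▸ ▸ ▴ ▸ ▾ ▸ ▴ ■) (▾ ▾ ▸ ▴ ▸ ▾ ■)
five-end₀ = checked

five-end : Piece (ends (1 , 4) (0 , 4) (3 , 4) (2 , 4)) (ends (4 , 1) (4 , 0) (4 , 3) (4 , 2)) (box 0 5 0 4) 2
  (▾ ◂ ▾ ▸ ▾ ◂ ▾ ▸ ▸ ▴ ▸ ▾ ▸ ▴ ■) (▾ ▾ ▸ ▴ ▸ ▾ ■)
five-end = checked

five-top : ∀ y → Open (_∈ᵇ box 0 5 y 4) 20 3 (shiftEnds (0 , y) (ends (1 , 0) (0 , 0) (2 , 1) (2 , 0)))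
five-top y = begin-at {w = ◂ ▴ ▸ ▴ ◂ ▴ ▸ ▸ ▾ ▸ ▴ ▸ ▾ ▾ ▾ ◂ ▴ ◂ ▾ ■} (0 , y)

five-tower : ∀ k y → Open (_∈ᵇ box 0 5 y (height k 6)) (5 * height k 6) (k * 2 + 6) (shiftEnds (0 , y) (ends (1 , 0) (0 , 0) (3 , 0) (2 , 0)))
five-tower zero    y = relabel (stack 4) (unstack 4) refl refl (extend (0 , y) (five-top (2 + y)) five-rows₀)
five-tower (suc k) y = relabel (stack (height k 6)) (unstack (height k 6)) (area₂ 5 (height k 6)) refl (extend (0 , y) (five-tower k (2 + y)) five-rows)

five : ∀ k → Narrow 4 (8 + k * 2) (6 + k * 2)
five zero    = relabel (λ r → box⇒rect (stack 4 r)) (λ r → unstack 4 (rect⇒box r)) refl refl (extend (0 , 0) (five-top 4) five-end₀)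
five (suc k) = relabel (λ {c} r → subst (λ n → Rect 5 n c) eq (box⇒rect (stack (height k 6) r)))
                       (λ {c} r → unstack (height k 6) (rect⇒box (subst (λ n → Rect 5 n c) (sym eq) r)))
                       (trans (area₄ 5 (height k 6)) (cong (5 *_) eq)) (cong (2 +_) (+-comm (k * 2) 6))
                       (extend (0 , 0) (five-tower k 4) five-end)
  where
  eq : height k 6 + 4 ≡ 10 + k * 2
  eq = trans (cong (_+ 4) (height≡ k 6)) (trans (+-assoc (k * 2) 6 4) (+-comm (k * 2) 10))

-- Starts the family m = n + 1, n ≡ 1 (mod 4): the narrow path with five columns needs at least eight rows.
nine : Narrow 8 10 8
nine = from-word (shiftEnds (8 , 0) narrowEnds)
  (▾ ◂ ▴ ◂ ▾ ◂ ▴ ◂ ▾ ◂ ▴ ◂ ▾ ◂ ◂ ▴ ▸ ▴ ◂ ▴ ▸ ▴ ◂ ▴ ▸ ▴ ◂ ▴ ▸ ▴ ◂ ▴ ▸ ▸ ▾ ▸ ▴ ▸ ▾ ▸ ▴ ▸ ▾ ▸ ▴ ▸ ▾ ▾ ◂ ▾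
   ▸ ▾ ▾ ◂ ▴ ◂ ▾ ◂ ◂ ▴ ▸ ▴ ▸ ▴ ◂ ◂ ▾ ◂ ▴ ◂ ▾ ▾ ▸ ▾ ◂ ▾ ▾ ▸ ▴ ▸ ▾ ▸ ▴ ▸ ▾ ▸ ▴ ▸ ▾ ■)

six-by-five : Closed (Rect 6 5) 30 6
six-by-five = close {e = ends (0 , 0) (1 , 0) (1 , 1) (0 , 1)} (0 , 0) (from-word _
  (▸ ▸ ▴ ▴ ▸ ▾ ▾ ▸ ▸ ▴ ◂ ▴ ▸ ▴ ▴ ◂ ▾ ◂ ▴ ◂ ▾ ◂ ▴ ◂ ▾ ▾ ▸ ▾ ◂ ■)) refl

-- Four straight cells in six columns: the density 2/3 per column of the lower bound for odd q.
six-columns : Piece narrowEnds (shiftEnds (6 , 0) narrowEnds) (box 1 6 0 6) 4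
  (▸ ▾ ▸ ▸ ▴ ◂ ▴ ▸ ▴ ▸ ▾ ▸ ▾ ◂ ▾ ▸ ▸ ▴ ■)
  (▸ ▴ ▸ ▴ ◂ ▴ ▸ ▸ ▾ ▸ ▴ ▸ ▸ ▾ ◂ ▾ ▸ ▾ ■)
six-columns = checked

beside : ∀ {m n c} → (Rect (suc m) n ⊔ᵇ box (suc m) 6 0 n) c → Rect (7 + m) n c
beside {m} {n} (inj₁ (p , q))         = <-≤-trans p (m≤n+m (suc m) 6) , q
beside {m} {n} (inj₂ (_ , p , _ , q)) = p , subst (_ <_) (+-identityʳ n) q

aside : ∀ {m n c} → Rect (7 + m) n c → (Rect (suc m) n ⊔ᵇ box (suc m) 6 0 n) c
aside {m} {n} {x , y} (p , q) with x <? suc m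
... | yes r = inj₁ (r , q)
... | no ¬r = inj₂ (≮⇒≥ ¬r , p , z≤n , subst (y <_) (sym (+-identityʳ n)) q)

widen : ∀ j {m s} → Narrow m 6 s → Narrow (j * 6 + m) 6 (j * 4 + s)
widen zero            P = P
widen (suc j) {m} {s} P = relabel beside aside (area (j * 6 + m)) refl (extend (j * 6 + m , 0) (widen j P) six-columns)
  where
  area : ∀ m → 36 + suc m * 6 ≡ (7 + m) * 6
  area = solve-∀

-- The numbers of columns 3, 5, 6, 7, 8 and 10 of this and the following paths represent all
-- residues modulo 6; with `widen` they reach every number from 7 on, as m > n = 6 demands.
six-three : Narrow 2 6 4
six-three = from-word (shiftEnds (2 , 0) narrowEnds)
  (▾ ◂ ◂ ▴ ▸ ▴ ◂ ▴ ▸ ▴ ◂ ▴ ▸ ▸ ▾ ▾ ▾ ■)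

six-five : Narrow 4 6 6
six-five = from-word (shiftEnds (4 , 0) narrowEnds)
  (▾ ◂ ▴ ◂ ▾ ◂ ◂ ▴ ▸ ▴ ◂ ▴ ▸ ▴ ◂ ▴ ▸ ▸ ▸ ▸ ▾ ◂ ◂ ▾ ▾ ▸ ▴ ▸ ▾ ■)

six-six : Narrow 5 6 6
six-six = from-word (shiftEnds (5 , 0) narrowEnds)
  (▾ ◂ ◂ ▴ ▸ ▴ ◂ ▴ ◂ ▾ ▾ ▾ ◂ ◂ ▴ ▸ ▴ ◂ ▴ ▸ ▴ ◂ ▴ ▸ ▸ ▾ ▸ ▴ ▸ ▸ ▾ ◂ ▾ ▸ ▾ ■)

six-seven : Narrow 6 6 6
six-seven = from-word (shiftEnds (6 , 0) narrowEnds)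
  (▾ ◂ ◂ ▴ ▸ ▴ ◂ ▴ ◂ ◂ ▾ ▸ ▾ ▾ ◂ ▴ ◂ ▾ ◂ ▴ ▴ ▸ ▴ ◂ ▴ ▴ ▸ ▾ ▸ ▴ ▸ ▾ ▸ ▴ ▸ ▸ ▾ ◂ ▾ ▸ ▾ ■)

six-eight : Narrow 7 6 8
six-eight = from-word (shiftEnds (7 , 0) narrowEnds)
  (▾ ◂ ◂ ▴ ▸ ▴ ◂ ▴ ◂ ▾ ◂ ▴ ◂ ▾ ▾ ▸ ▸ ▾ ◂ ◂ ◂ ◂ ▴ ▸ ▴ ◂ ▴ ▸ ▴ ◂ ▴ ▸ ▸ ▾ ▸ ▴ ▸ ▾ ▸ ▴ ▸ ▸ ▾ ◂ ▾ ▸ ▾ ■)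

six-ten : Narrow 9 6 8
six-ten = from-word (shiftEnds (9 , 0) narrowEnds)
  (▾ ◂ ◂ ▴ ▸ ▴ ◂ ▴ ◂ ▾ ◂ ▾ ▸ ▾ ◂ ◂ ▴ ◂ ▾ ◂ ▴ ◂ ▾ ◂ ▴ ▴ ▸ ▴ ◂ ▴ ▴ ▸ ▾ ▸ ▴ ▸ ▾ ▾ ◂ ▾ ▸ ▸ ▴ ▸ ▴ ◂ ▴ ▸ ▸ ▾
   ▸ ▴ ▸ ▸ ▾ ◂ ▾ ▸ ▾ ■)

-- From closed lists of cells to Hamilton cycles

next-spec : ∀ {N} (i : Fin N) → toℕ (nextF i) ≡ suc (toℕ i) ⊎ (toℕ (nextF i) ≡ 0 × suc (toℕ i) ≡ N)
next-spec {suc k} i with suc (toℕ i) <? suc k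
... | yes p = inj₁ (toℕ-fromℕ< p)
... | no ¬p = inj₂ (refl , ≤-antisym (toℕ<n i) (≮⇒≥ ¬p))

prev-spec : ∀ {N} (i : Fin N) → toℕ i ≡ suc (toℕ (prevF i)) ⊎ (toℕ i ≡ 0 × suc (toℕ (prevF i)) ≡ N)
prev-spec {suc k} zero    = inj₂ (refl , cong suc (toℕ-fromℕ k))
prev-spec {suc k} (suc j) = inj₁ (cong suc (sym (toℕ-inject₁ j)))

-- Finite sums and positions in lists

Σ< : ℕ → (ℕ → ℕ) → ℕ
Σ< zero    f = 0
Σ< (suc n) f = f 0 + Σ< n (f ∘ suc)

Σ<-last : ∀ n f → Σ< (suc n) f ≡ Σ< n f + f n
Σ<-last zero    f = +-comm (f 0) 0
Σ<-last (suc n) f = trans (cong (f 0 +_) (Σ<-last n (f ∘ suc))) (sym (+-assoc (f 0) _ _))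

Σ<-cong : ∀ n {f g} → (∀ i → i < n → f i ≡ g i) → Σ< n f ≡ Σ< n g
Σ<-cong zero    e = refl
Σ<-cong (suc n) e = cong₂ _+_ (e 0 (s≤s z≤n)) (Σ<-cong n (λ i p → e (suc i) (s≤s p)))

-- An inequality suffices for the constructed cycles, because the lower bounds on straight cells
-- supply the converse.
count-filter : ∀ {A : Set} {P : A → Set} (P? : Decidable P) N (f : Fin N → A) (α : ℕ → ℕ) →
               (∀ i → ¬ P (f i) → 1 ≤ α (toℕ i)) → N ≤ length (filter P? (tabulate f)) + Σ< N α
count-filter P? zero    f α h = z≤n
count-filter P? (suc N) f α h with P? (f zero)
... | yes p = s≤s (≤-trans (count-filter P? N (f ∘ suc) (α ∘ suc) (λ i → h (suc i))) (+-monoʳ-≤ (length (filter P? (tabulate (f ∘ suc)))) (m≤n+m _ (α 0))))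
... | no ¬p = ≤-trans (+-mono-≤ (h zero ¬p) (count-filter P? N (f ∘ suc) (α ∘ suc) (λ i → h (suc i))))
                      (≤-reflexive (rearrange (α 0) (length (filter P? (tabulate (f ∘ suc)))) _))
  where
  rearrange : ∀ a b c → a + (b + c) ≡ b + (a + c)
  rearrange = solve-∀

at : List Pt → ℕ → Pt
at []      i       = 0 , 0
at (c ∷ l) zero    = c
at (c ∷ l) (suc i) = at l i

at-∈ : ∀ l i → i < length l → at l i ∈ l
at-∈ (c ∷ l) zero    _       = here refl
at-∈ (c ∷ l) (suc i) (s≤s p) = there (at-∈ l i p)

∈-at : ∀ {l c} → c ∈ l → ∃ λ i → i < length l × at l i ≡ c
∈-at (here refl) = 0 , s≤s z≤n , refl
∈-at (there c∈)  = let i , p , e = ∈-at c∈ in suc i , s≤s p , e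

at-++ˡ : ∀ l r i → i < length l → at (l ++ r) i ≡ at l i
at-++ˡ (c ∷ l) r zero    _       = refl
at-++ˡ (c ∷ l) r (suc i) (s≤s p) = at-++ˡ l r i p

at-++ʳ : ∀ l r i → at (l ++ r) (length l + i) ≡ at r i
at-++ʳ []      r i = refl
at-++ʳ (c ∷ l) r i = at-++ʳ l r i

at-chain : ∀ l i → Chain l → suc i < length l → Adj (at l i) (at l (suc i))
at-chain (a ∷ b ∷ l) zero    (e ∷ _)  _       = e
at-chain (a ∷ b ∷ l) (suc i) (_ ∷ es) (s≤s p) = at-chain (b ∷ l) i es p
at-chain (a ∷ [])    i       _        (s≤s ())

straights-at : ∀ N l → length l ≡ 2 + N → straights l ≡ Σ< N (λ j → aligned (at l j) (at l (2 + j)))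
straights-at zero    (a ∷ b ∷ [])    _ = refl
straights-at (suc N) (a ∷ b ∷ c ∷ l) e = cong (aligned a c +_) (straights-at N (b ∷ c ∷ l) (suc-injective e))

missed-value : ∀ {N} (z : Fin N) (G : Fin N → Fin N) → (∀ x → G x ≢ z) → Injective _≡_ _≡_ G → ⊥
missed-value {suc N} z G ne inj =
  1+n≰n (injective⇒≤ {f = λ x → punchOut (avoid x)} (λ {x} {y} p → inj (punchOut-injective (avoid x) (avoid y) p)))
  where
  avoid : ∀ x → z ≢ G x
  avoid x p = ne x (sym p)

module _ {m n} (f : Fin (m * n) → Fin m × Fin n) (g : Fin m × Fin n → Fin (m * n)) (fg : ∀ c → f (g c) ≡ c) where

  -- The pigeonhole principle: g is injective, so after numbering the cells it is an injective map
  -- of `Fin (m * n)` into itself and cannot miss z.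
  section-onto : ∀ z → g (f z) ≡ z
  section-onto z with g (f z) ≟ᶠ z
  ... | yes p = p
  ... | no ¬p = ⊥-elim (missed-value z (g ∘ remQuot n)
    (λ x p → ¬p (subst (λ c → g c ≡ z) (trans (sym (fg (remQuot n x))) (cong f p)) p))
    (λ {x} {y} p → trans (sym (combine-remQuot {m} n x))
      (trans (cong (uncurry combine) (trans (sym (fg _)) (trans (cong f p) (fg _)))) (combine-remQuot {m} n y))))

  section⇒injective : Injective _≡_ _≡_ f
  section⇒injective {i} {j} e = trans (sym (section-onto i)) (trans (cong g e) (section-onto j))

toPt : ∀ {m n} → Cell m n → Pt
toPt (x , y) = toℕ x , toℕ y

toPt-injective : ∀ {m n} {c d : Cell m n} → toPt c ≡ toPt d → c ≡ d
toPt-injective e = cong₂ _,_ (toℕ-injective (cong proj₁ e)) (toℕ-injective (cong proj₂ e))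

nextF-prevF : ∀ {N} (i : Fin N) → nextF (prevF i) ≡ i
nextF-prevF i with prev-spec i | next-spec (prevF i)
... | inj₁ p       | inj₁ q       = toℕ-injective (trans q (sym p))
... | inj₁ p       | inj₂ (_ , q) = ⊥-elim (<-irrefl (trans p q) (toℕ<n i))
... | inj₂ (_ , p) | inj₁ q       = ⊥-elim (<-irrefl (trans q p) (toℕ<n (nextF (prevF i))))
... | inj₂ (p , _) | inj₂ (q , _) = toℕ-injective (trans q (sym p))

same : ∀ {n} (i j : Fin n) → ∣ toℕ i - toℕ j ∣ ≡ 0 → i ≡ j
same i j e = toℕ-injective (∣m-n∣≡0⇒m≡n e)

isZero-0 : ∀ {k} → k ≡ 0 → 1 ≤ isZero k
isZero-0 refl = s≤s z≤n

-- At a cell that is not a turn both edges have the same direction, so its two neighbours agree in a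
-- coordinate and the product of their distances vanishes.
bent⇒turn : ∀ {m n} (a b c : Cell m n) → Adjacent a b → Adjacent b c →
            ¬ ((Horizontal a b × Vertical b c) ⊎ (Vertical a b × Horizontal b c)) → 1 ≤ aligned (toPt a) (toPt c)
bent⇒turn a@(ax , ay) b@(bx , by) c@(cx , cy) ab bc ¬t with ∣ toℕ ax - toℕ bx ∣ in p | ∣ toℕ bx - toℕ cx ∣ in q
... | zero  | suc k = ⊥-elim (¬t (inj₂ (same ax bx p , same by cy (m+n≡0⇒n≡0 k (suc-injective bc)))))
... | suc j | zero  = ⊥-elim (¬t (inj₁ (same ay by (m+n≡0⇒n≡0 j (suc-injective ab)) , same bx cx q)))
... | zero  | zero  with refl ← same ax bx p | refl ← same bx cx q =
  isZero-0 (cong (_* ∣ toℕ ay - toℕ cy ∣) (∣n-n∣≡0 (toℕ ax)))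
... | suc j | suc k with refl ← same ay by (m+n≡0⇒n≡0 j (suc-injective ab)) | refl ← same by cy (m+n≡0⇒n≡0 k (suc-injective bc)) =
  isZero-0 (trans (cong (∣ toℕ ax - toℕ cx ∣ *_) (∣n-n∣≡0 (toℕ ay))) (*-zeroʳ ∣ toℕ ax - toℕ cx ∣))

-- The window starting at position j has cell j + 1 as its middle; the cyclic shift indexes windows
-- by their middle cells.
shifted : ℕ → (ℕ → ℕ) → ℕ → ℕ
shifted N τ zero    = τ (pred N)
shifted N τ (suc j) = τ j

Σ<-shifted : ∀ N τ → Σ< N (shifted N τ) ≡ Σ< N τ
Σ<-shifted zero    τ = refl
Σ<-shifted (suc N) τ = trans (+-comm (τ N) _) (sym (Σ<-last N τ))

module _ {m n s} (P : Closed (Rect m n) (m * n) s) where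
  open Closed P
  private
    N = m * n
    E = path ++ a ∷ b ∷ []

    length-E : length E ≡ 2 + N
    length-E = trans (length-++ path) (trans (cong (_+ 2) size) (+-comm N 2))

    at-E : ∀ i → i < N → at E i ≡ at path i
    at-E i p = at-++ˡ path _ i (subst (i <_) (sym size) p)

    at-N : at E N ≡ a
    at-N = trans (cong (at E) (trans (sym size) (sym (+-identityʳ _)))) (at-++ʳ path _ 0)

    at-1+N : at E (suc N) ≡ b
    at-1+N = trans (cong (at E) (trans (+-comm 1 N) (cong (_+ 1) (sym size)))) (at-++ʳ path _ 1)

    inRange : ∀ i → i < N → Rect m n (at path i)
    inRange i p = sound (at-∈ path i (subst (i <_) (sym size) p))

    cellAt : Fin N → Cell m n
    cellAt i = let p , q = inRange (toℕ i) (toℕ<n i) in fromℕ< p , fromℕ< q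

    toPt-cellAt : ∀ i → toPt (cellAt i) ≡ at E (toℕ i)
    toPt-cellAt i = let p , q = inRange (toℕ i) (toℕ<n i) in
      trans (cong₂ _,_ (toℕ-fromℕ< p) (toℕ-fromℕ< q)) (sym (at-E (toℕ i) (toℕ<n i)))

    toPt-next : ∀ i → toPt (cellAt (nextF i)) ≡ at E (suc (toℕ i))
    toPt-next i with next-spec i
    ... | inj₁ e       = trans (toPt-cellAt (nextF i)) (cong (at E) e)
    ... | inj₂ (e , f) = trans (toPt-cellAt (nextF i)) (trans (cong (at E) e) (sym (trans (cong (at E) f) at-N)))

    locate : ∀ (c : Cell m n) → ∃ λ i → i < N × at path i ≡ toPt c
    locate c = let i , p , e = ∈-at (complete {toPt c} (toℕ<n _ , toℕ<n _)) in i , subst (i <_) size p , e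

    where-is : Cell m n → Fin N
    where-is c = fromℕ< (proj₁ (proj₂ (locate c)))

    cellAt-where : ∀ c → cellAt (where-is c) ≡ c
    cellAt-where c = let i , p , e = locate c in
      toPt-injective (trans (toPt-cellAt (where-is c)) (trans (cong (at E) (toℕ-fromℕ< p)) (trans (at-E i p) e)))

    adjacent : ∀ i → Adjacent (cellAt i) (cellAt (nextF i))
    adjacent i = subst₂ Adj (sym (toPt-cellAt i)) (sym (toPt-next i))
      (at-chain E (toℕ i) chain (subst (suc (toℕ i) <_) (sym length-E) (s≤s (m≤n⇒m≤1+n (toℕ<n i)))))

  hamCycle : HamCycle m n
  hamCycle = record
    { cell = cellAt
    ; inj  = section⇒injective cellAt where-is cellAt-where
    ; surj = λ c → where-is c , λ { refl → cellAt-where c }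
    ; adj  = adjacent }

  private
    τ : ℕ → ℕ
    τ j = aligned (at E j) (at E (2 + j))

    straight-at : ∀ i → ¬ IsTurn hamCycle i → 1 ≤ shifted N τ (toℕ i)
    straight-at i ¬t = by-position (prev-spec i)
      where
      p = toℕ (prevF i)
      straight : 1 ≤ aligned (at E p) (at E (suc (toℕ i)))
      straight = subst₂ (λ u v → 1 ≤ aligned u v) (toPt-cellAt (prevF i)) (toPt-next i)
        (bent⇒turn _ (cellAt i) _ (subst (λ j → Adjacent (cellAt (prevF i)) (cellAt j)) (nextF-prevF i) (adjacent (prevF i))) (adjacent i) ¬t)
      by-position : toℕ i ≡ suc p ⊎ (toℕ i ≡ 0 × suc p ≡ N) → 1 ≤ shifted N τ (toℕ i)
      by-position (inj₁ e)       = subst (λ k → 1 ≤ shifted N τ k) (sym e) (subst (λ k → 1 ≤ aligned (at E p) (at E (suc k))) e straight)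
      by-position (inj₂ (e , f)) = subst (λ k → 1 ≤ shifted N τ k) (sym e) (subst (λ k → 1 ≤ τ k) (cong pred f)
        (subst (λ c → 1 ≤ aligned (at E p) c) (trans (cong (at E ∘ suc) e) (sym (trans (cong (at E ∘ suc) f) at-1+N))) straight))

  many-turns : m * n ≤ turns hamCycle + s
  many-turns = subst (λ z → N ≤ turns hamCycle + z)
    (trans (Σ<-shifted N τ) (trans (sym (straights-at N E length-E)) count))
    (count-filter (isTurn? hamCycle) N id (shifted N τ) straight-at)

-- Sequences of column counts

-- X ≤ Y as a linear consequence of L ≤ R, with the equation Y − X = (R − L) + w freed of subtractions.
linear : ∀ {L R X Y} w → L ≤ R → Y + L ≡ X + R + w → X ≤ Y
linear {L} {R} {X} {Y} w p e = +-cancelʳ-≤ L X Y (begin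
  X + L       ≤⟨ +-monoʳ-≤ X p ⟩
  X + R       ≤⟨ m≤m+n (X + R) w ⟩
  X + R + w   ≡⟨ sym e ⟩
  Y + L       ∎)
  where open ≤-Reasoning

infixl 5 _⊕_
_⊕_ : ∀ {a b c d} → a ≤ b → c ≤ d → a + c ≤ b + d
_⊕_ = +-mono-≤

even-positive : ∀ {s} → 2 ∣ s → s ≢ 0 → 2 ≤ s
even-positive (divides zero refl)    ne = ⊥-elim (ne refl)
even-positive (divides (suc k) refl) _  = s≤s (s≤s z≤n)

prefix : (ℕ → ℕ) → ℕ → ℕ
prefix st zero    = 0
prefix st (suc i) = prefix st i + st i

prefix-mono : ∀ st {i j} → i ≤ j → prefix st i ≤ prefix st j
prefix-mono st {i} {zero}  z≤n = ≤-refl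
prefix-mono st {i} {suc j} p with m≤n⇒m<n∨m≡n p
... | inj₁ (s≤s q) = ≤-trans (prefix-mono st q) (m≤m+n _ (st j))
... | inj₂ refl    = ≤-refl

odd : ℕ → Bool
odd zero    = false
odd (suc i) = not (odd i)

data Parity : ℕ → Set where
  evenly : ∀ k → Parity (k * 2)
  oddly  : ∀ k → Parity (suc (k * 2))

parity : ∀ i → Parity i
parity zero = evenly 0
parity (suc i) with parity i
... | evenly k = oddly k
... | oddly k  = evenly (suc k)

odd-2k : ∀ k → odd (k * 2) ≡ false
odd-2k zero    = refl
odd-2k (suc k) = trans (not-involutive (odd (k * 2))) (odd-2k k)

-- h i counts the cycle edges between columns i − 1 and i, st i the straight cells of column i,
-- in a grid with q + q rows.
record Profile (m q : ℕ) (h st : ℕ → ℕ) : Set where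
  field
    first : h 0 ≡ 0
    last  : h m ≡ 0
    upper : ∀ i → i < m → h i + h (suc i) ≤ q + q + st i
    lower : ∀ i → i < m → q + q ≤ h i + h (suc i) + st i
    pair  : ∀ i → suc i < m → st i ≡ 0 → st (suc i) ≡ 0 → h (suc i) ≤ q
    evenH : ∀ i → i ≤ m → 2 ∣ h i
    evenS : ∀ i → i < m → 2 ∣ st i

reversed-prefix : ∀ m st k → k ≤ m → prefix (λ i → st (m ∸ suc i)) k + prefix st (m ∸ k) ≡ prefix st m
reversed-prefix m st zero    p = refl
reversed-prefix m st (suc k) p = trans (+-assoc (prefix _ k) _ _)
  (trans (cong (prefix (λ i → st (m ∸ suc i)) k +_) (trans (+-comm (st (m ∸ suc k)) _) (cong (prefix st) (sym (+-∸-assoc 1 p)))))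
         (reversed-prefix m st k (<⇒≤ p)))

reversed : ∀ {m q h st} → Profile m q h st → Profile m q (λ i → h (m ∸ i)) (λ i → st (m ∸ suc i))
reversed {m} {q} {h} {st} P = record
  { first = last
  ; last  = trans (cong h (n∸n≡0 m)) first
  ; upper = λ i p → subst (λ z → h z + h (m ∸ suc i) ≤ q + q + st (m ∸ suc i)) (sym (+-∸-assoc 1 p))
                      (subst (_≤ q + q + st (m ∸ suc i)) (+-comm (h (m ∸ suc i)) _) (upper (m ∸ suc i) (m>0 p)))
  ; lower = λ i p → subst (λ z → q + q ≤ h z + h (m ∸ suc i) + st (m ∸ suc i)) (sym (+-∸-assoc 1 p))
                      (subst (λ z → q + q ≤ z + st (m ∸ suc i)) (+-comm (h (m ∸ suc i)) _) (lower (m ∸ suc i) (m>0 p)))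
  ; pair  = λ i p s t → let e = +-∸-assoc 1 p in
                        subst (λ z → h z ≤ q) (sym e) (pair (m ∸ suc (suc i)) (subst (_< m) e (m>0 (<⇒≤ p))) t
                          (subst (λ z → st z ≡ 0) e s))
  ; evenH = λ i p → evenH (m ∸ i) (m∸n≤m m i)
  ; evenS = λ i p → evenS (m ∸ suc i) (m>0 p) }
  where
  open Profile P
  m>0 : ∀ {i} → i < m → m ∸ suc i < m
  m>0 {i} p = ∸-monoʳ-< (s≤s z≤n) p

module Bounds {m q h st} (P : Profile m q h st) where
  open Profile P
  A = prefix st

  mutual
    -- Consecutive values of h add up to about 2q, so from h 0 = 0 on they alternate between about 0
    -- and about 2q; the accumulated error is at most the number of straight cells passed.
    even-height : ∀ k → k * 2 ≤ m → h (k * 2) ≤ A (k * 2)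
    even-height zero    _ = ≤-reflexive first
    even-height (suc k) p = linear 0 (upper (suc (k * 2)) p ⊕ odd-height k (<⇒≤ p)) (eq (h (suc (k * 2))) (h (2 + k * 2)) q (st (suc (k * 2))) (A (suc (k * 2))))
      where
      eq : ∀ a b q s A → (A + s) + ((a + b) + (q + q)) ≡ b + ((q + q + s) + (a + A)) + 0
      eq = solve-∀

    odd-height : ∀ k → suc (k * 2) ≤ m → q + q ≤ h (suc (k * 2)) + A (suc (k * 2))
    odd-height k p = linear 0 (lower (k * 2) p ⊕ even-height k (<⇒≤ p)) (eq (h (k * 2)) (h (suc (k * 2))) q (st (k * 2)) (A (k * 2)))
      where
      eq : ∀ a b q s A → (b + (A + s)) + ((q + q) + a) ≡ (q + q) + ((a + b + s) + A) + 0
      eq = solve-∀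

  not-both-free : ∀ i → suc i < m → q < h (suc i) → 2 ≤ st i + st (suc i)
  not-both-free i p r with st i ≟ 0 | st (suc i) ≟ 0
  ... | yes a | yes b = ⊥-elim (<⇒≱ r (pair i p a b))
  ... | no ¬a | _     = ≤-trans (even-positive (evenS i (<⇒≤ p)) ¬a) (m≤m+n _ _)
  ... | yes _ | no ¬b = ≤-trans (even-positive (evenS (suc i) p) ¬b) (m≤n+m _ _)

  paired : ∀ k → k * 2 ≤ m → (∀ j → j < k → q < h (suc (j * 2))) → k * 2 ≤ A (k * 2)
  paired zero    p r = z≤n
  paired (suc k) p r = linear 0 (paired k (≤-trans (m≤n+m _ 2) p) (λ j l → r j (m<n⇒m<1+n l)) ⊕ not-both-free (k * 2) p (r k ≤-refl))
                              (eq (k * 2) (A (k * 2)) (st (k * 2)) (st (suc (k * 2))))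
    where
    eq : ∀ a A s t → (A + s + t) + (a + 2) ≡ (2 + a) + (A + (s + t)) + 0
    eq = solve-∀

-- This is `odd-height` seen from the right end: an odd number of columns remains from i on.
suffix-odd : ∀ {m q h st} → Profile m q h st → ∀ l i → suc (l * 2) + i ≡ m → q + q + prefix st i ≤ h i + prefix st m
suffix-odd {m} {q} {h} {st} P l i refl =
  linear 0 (Bounds.odd-height (reversed P) l (m≤m+n _ i))
    (trans (cong₂ (λ a b → h i + a + b) (sym (reversed-prefix m st (suc (l * 2)) (m≤m+n _ i))) refl)
    (trans (cong (λ a → h i + (prefix st′ (suc (l * 2)) + prefix st a) + (q + q)) i≡)
    (trans (eq (h i) (prefix st′ (suc (l * 2))) (prefix st i) q) (cong (λ a → q + q + prefix st i + (h a + prefix st′ (suc (l * 2))) + 0) (sym i≡)))))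
  where
  st′ = λ j → st (m ∸ suc j)
  i≡ : m ∸ suc (l * 2) ≡ i
  i≡ = m+n∸m≡n (l * 2) i
  eq : ∀ h a b q → h + (a + b) + (q + q) ≡ q + q + b + (h + a) + 0
  eq = solve-∀

-- Either each column pair (2j , 2j + 1) contributes 2, or some boundary inside a pair is crossed at most q times;
-- the alternating sums of h i + h (i + 1) ≈ 2q over the columns on its two sides then contribute q each.
rows-bound : ∀ {m q h st} → Profile m q h st → q + q ≤ m → q + q ≤ prefix st m
rows-bound {m} {q} {h} {st} P n≤m with parity m
-- For odd m the alternation would make h m about 2q, whereas it is 0.
... | oddly k = subst (λ z → q + q ≤ z + prefix st m) (Profile.last P) (Bounds.odd-height P k ≤-refl)
... | evenly k with scan k ≤-refl
  where
  open Bounds P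
  scan : ∀ j → j ≤ k → (∀ i → i < j → q < h (suc (i * 2))) ⊎ ∃ λ i → i < k × h (suc (i * 2)) ≤ q
  scan zero    _ = inj₁ λ _ ()
  scan (suc j) p with scan j (<⇒≤ p) | h (suc (j * 2)) ≤? q
  ... | inj₂ r | _     = inj₂ r
  ... | inj₁ _ | yes r = inj₂ (j , p , r)
  ... | inj₁ f | no ¬r = inj₁ λ i l → later i (m≤n⇒m<n∨m≡n l)
    where
    later : ∀ i → suc i < suc j ⊎ suc i ≡ suc j → q < h (suc (i * 2))
    later i (inj₁ (s≤s l)) = f i l
    later i (inj₂ refl)    = ≰⇒> ¬r
... | inj₁ f = ≤-trans n≤m (Bounds.paired P k ≤-refl f)
... | inj₂ (j , j<k , r) = linear 0 (Bounds.odd-height P j (<⇒≤ (*-monoˡ-≤ 2 j<k)) ⊕ suffix-odd P (k ∸ suc j) (suc (j * 2)) (split (m∸n+n≡m j<k)) ⊕ r ⊕ r)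
                             (eq q (h (suc (j * 2))) (prefix st (suc (j * 2))) (prefix st m))
  where
  split : ∀ {l} → l + suc j ≡ k → suc (l * 2) + suc (j * 2) ≡ k * 2
  split {l} refl = e l j
    where
    e : ∀ l j → suc (l * 2) + suc (j * 2) ≡ (l + suc j) * 2
    e = solve-∀
  eq : ∀ q h a b → b + ((q + q) + (q + q + a) + h + h) ≡ (q + q) + ((h + a) + (h + b) + q + q) + 0
  eq = solve-∀

Side : ℕ → Bool → ℕ → Set
Side q false x = x < q
Side q true  x = q < x

-- For odd q no boundary is crossed exactly q times. Boundary i is of kind false when h i < q for even i
-- or h i > q for odd i. One column in three must contain straight cells, but one in two as long as the
-- kind does not change.
module Kinds {m q h st} (q-odd : ¬ (2 ∣ q)) (P : Profile m q h st) where
  open Profile P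
  open Bounds P

  Kind : Bool → ℕ → Set
  Kind b i = Side q (odd i xor b) (h i)

  kind : ∀ i → i ≤ m → Kind false i ⊎ Kind true i
  kind i p with odd i | <-cmp (h i) q
  ... | false | tri< a _ _ = inj₁ a
  ... | true  | tri< a _ _ = inj₂ a
  ... | false | tri> _ _ c = inj₂ c
  ... | true  | tri> _ _ c = inj₁ c
  ... | _     | tri≈ _ e _ = ⊥-elim (q-odd (subst (2 ∣_) e (evenH i p)))

  exclusive : ∀ i → Kind false i → Kind true i → ⊥
  exclusive i a b with odd i
  ... | false = <-asym a b
  ... | true  = <-asym a b

  scan : ∀ i → i ≤ m → (∀ j → j ≤ i → Kind false j) ⊎ ∃ λ c → c ≤ m × Kind true c × (∀ j → j < c → Kind false j)
  scan zero    p with kind zero p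
  ... | inj₁ a = inj₁ λ { zero z≤n → a }
  ... | inj₂ b = inj₂ (0 , z≤n , b , λ _ ())
  scan (suc i) p with scan i (<⇒≤ p) | kind (suc i) p
  ... | inj₂ r | _      = inj₂ r
  ... | inj₁ f | inj₂ b = inj₂ (suc i , p , b , λ { j (s≤s l) → f j l })
  ... | inj₁ f | inj₁ a = inj₁ λ j l → later j (m≤n⇒m<n∨m≡n l)
    where
    later : ∀ j → j < suc i ⊎ j ≡ suc i → Kind false j
    later j (inj₁ (s≤s l)) = f j l
    later j (inj₂ refl)    = a

  at-even : ∀ {b} k → Kind b (k * 2) → Side q b (h (k * 2))
  at-even k x rewrite odd-2k k = x

  at-odd : ∀ {b} k → Kind b (suc (k * 2)) → Side q (not b) (h (suc (k * 2)))
  at-odd k x rewrite odd-2k k = x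

  blocks : ∀ k → k * 2 ≤ m → (∀ j → j < k * 2 → Kind false j) → k * 2 ≤ A (k * 2)
  blocks k p f = paired k p (λ j l → at-odd j (f (suc (j * 2)) (*-monoˡ-≤ 2 l)))

  -- Two of the three copies of A c are at least c, by the column pairs before the change. The third
  -- exceeds q: at the change h is on the wrong side of q, so the alternation has been disturbed by
  -- more than q.
  first-change : ∀ c → c ≤ m → Kind true c → (∀ j → j < c → Kind false j) → c + c + suc q ≤ A c + A c + A c
  first-change c p x f with parity c
  ... | evenly k = blocks k p f ⊕ blocks k p f ⊕ ≤-trans (at-even k x) (even-height k p)
  ... | oddly k = c≤A ⊕ c≤A ⊕ linear 0 (odd-height k p ⊕ at-odd k x) (eq (h c) (A c) q)
    where
    eq : ∀ h A q → A + (q + q + suc h) ≡ suc q + (h + A + q) + 0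
    eq = solve-∀
    -- Boundaries c - 1 and c are both crossed fewer than q times, so the column between them has
    -- straight cells; these make up for its having no partner.
    st≢0 : st (k * 2) ≢ 0
    st≢0 e = 1+n≰n (linear {X = suc (q + q)} 1 (lower (k * 2) p ⊕ at-even k (f (k * 2) ≤-refl) ⊕ at-odd k x)
      (trans (eq′ q (h (k * 2)) (h c)) (cong (λ s → suc (q + q) + (h (k * 2) + h c + s + q + q) + 1) (sym e))))
      where
      eq′ : ∀ q a b → q + q + (q + q + suc a + suc b) ≡ suc (q + q) + (a + b + 0 + q + q) + 1
      eq′ = solve-∀
    c≤A : suc (k * 2) ≤ A c
    c≤A = linear 1 (blocks k (<⇒≤ p) (λ j l → f j (m<n⇒m<1+n l)) ⊕ even-positive (evenS (k * 2) p) st≢0) (eq″ (k * 2) (A (k * 2)) (st (k * 2)))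
      where
      eq″ : ∀ k A s → A + s + (k + 2) ≡ suc k + (A + s) + 1
      eq″ = solve-∀

  three-columns : ∀ i → 3 + i ≤ m → 2 + A i ≤ A (3 + i)
  three-columns i p with st i ≟ 0 | st (1 + i) ≟ 0 | st (2 + i) ≟ 0
  ... | no ¬a | _     | _     = linear (st (1 + i) + st (2 + i)) (even-positive (evenS i (<⇒≤ (<⇒≤ p))) ¬a) (eq (A i) (st i) (st (1 + i)) (st (2 + i)))
    where
    eq : ∀ A s t u → A + s + t + u + 2 ≡ 2 + A + s + (t + u)
    eq = solve-∀
  ... | _     | no ¬b | _     = linear (st i + st (2 + i)) (even-positive (evenS (1 + i) (<⇒≤ p)) ¬b) (eq (A i) (st i) (st (1 + i)) (st (2 + i)))
    where
    eq : ∀ A s t u → A + s + t + u + 2 ≡ 2 + A + t + (s + u)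
    eq = solve-∀
  ... | _     | _     | no ¬c = linear (st i + st (1 + i)) (even-positive (evenS (2 + i) p) ¬c) (eq (A i) (st i) (st (1 + i)) (st (2 + i)))
    where
    eq : ∀ A s t u → A + s + t + u + 2 ≡ 2 + A + u + (s + t)
    eq = solve-∀
  -- Both boundaries of the middle column are crossed at most q times and together at least 2q
  -- times, hence q times each, an odd number.
  ... | yes a | yes b | yes c = ⊥-elim (q-odd (subst (2 ∣_) (≤-antisym l₁ l₂) (evenH (1 + i) (<⇒≤ (<⇒≤ p)))))
    where
    l₁ : h (1 + i) ≤ q
    l₁ = pair i (<⇒≤ p) a b
    l₂ : q ≤ h (1 + i)
    l₂ = linear 0 (subst (λ s → q + q ≤ h (1 + i) + h (2 + i) + s) b (lower (1 + i) (<⇒≤ p)) ⊕ pair (1 + i) p b c) (eq q (h (1 + i)) (h (2 + i)))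
      where
      eq : ∀ q a b → a + (q + q + b) ≡ q + (a + b + 0 + q) + 0
      eq = solve-∀

  -- Three columns contribute at least 2, so three times the contribution is at least twice the
  -- length; the 4 pays for up to two leftover columns.
  stretch : ∀ k i → k + i ≤ m → k + k + (A i + A i + A i) ≤ A (k + i) + A (k + i) + A (k + i) + 4
  stretch 0 i p = m≤m+n _ 4
  stretch 1 i p = linear (2 + st i + st i + st i) (≤-refl {0}) (eq (A i) (st i))
    where
    eq : ∀ A s → A + s + (A + s) + (A + s) + 4 + 0 ≡ 2 + (A + A + A) + 0 + (2 + s + s + s)
    eq = solve-∀
  stretch 2 i p = linear (s + s + s) (≤-refl {0}) (eq (A i) (st i) (st (1 + i)))
    where
    s = st i + st (1 + i)
    eq : ∀ A s t → A + s + t + (A + s + t) + (A + s + t) + 4 + 0 ≡ 4 + (A + A + A) + 0 + ((s + t) + (s + t) + (s + t))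
    eq = solve-∀
  stretch (suc (suc (suc k))) i p = linear 0 (stretch k i (≤-trans (m≤n+m _ 3) p) ⊕ t ⊕ t ⊕ t) (eq k (A i) (A (k + i)) (A (3 + k + i)))
    where
    t = three-columns (k + i) p
    eq : ∀ k A B C → C + C + C + 4 + (k + k + (A + A + A) + (2 + B) + (2 + B) + (2 + B))
                     ≡ 3 + k + (3 + k) + (A + A + A) + (B + B + B + 4 + C + C + C) + 0
    eq = solve-∀

odd-∸ : ∀ m i → i ≤ m → odd i ≡ odd (m ∸ i) xor odd m
odd-∸ m       zero    _       with odd m
... | false = refl
... | true  = refl
odd-∸ (suc m) (suc i) (s≤s p) rewrite odd-∸ m i p with odd (m ∸ i) | odd m
... | false | false = refl
... | false | true  = refl
... | true  | false = refl
... | true  | true  = refl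

module _ {m q h st} (q-odd : ¬ (2 ∣ q)) (P : Profile m q h st) (n≤m : q + q ≤ m) where
  private
    module K  = Kinds q-odd P
    module K′ = Kinds q-odd (reversed P)
    A  = prefix st
    A′ = prefix (λ i → st (m ∸ suc i))
    Claim = m + m + (q + q) ≤ A m + A m + A m + 2

    -- Seen from the right, the parity of a boundary changes by that of m, so for odd m the two
    -- kinds are exchanged.
    transfer : ∀ b j → j ≤ m → K′.Kind b j → K.Kind (odd m xor b) (m ∸ j)
    transfer b j p x = subst (λ z → Side q z (h (m ∸ j))) (trans (cong (_xor b) (odd-∸ m j p)) (xor-assoc (odd (m ∸ j)) (odd m) b)) x

    all-false : (∀ j → j ≤ m → K.Kind false j) → Parity m → Claim
    -- Here `n≤m` enters: A m ≥ m yields 3 A m ≥ 2m + n.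
    all-false f (evenly k) = ≤-trans (b ⊕ b ⊕ ≤-trans n≤m b) (m≤m+n _ 2)
      where b = K.blocks k ≤-refl (λ j l → f j (<⇒≤ l))
    all-false f (oddly k) = ⊥-elim (n≮0 (subst (q <_) (Profile.last P) (K.at-odd k (f m ≤-refl))))

    -- Since m is odd, one of the two stretches has odd length and the other even length, so
    -- rounding to column pairs loses a single column and m ≤ A m + 1. Odd m also gives n ≤ A m.
    one-change : ∀ c → c ≤ m → (∀ j → j < c → K.Kind false j) → (∀ j → j < m ∸ c → K′.Kind false j) → odd m ≡ true → Claim
    one-change c c≤m f f′ o = linear 0 (r ⊕ r ⊕ n≤A) (eq m (A m) q)
      where
      eq : ∀ m A q → A + A + A + 2 + (m + m + (q + q)) ≡ m + m + (q + q) + (suc A + suc A + A) + 0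
      eq = solve-∀
      n≤A : q + q ≤ A m
      n≤A with parity m
      ... | oddly k  = subst (λ z → q + q ≤ z + A m) (Profile.last P) (Bounds.odd-height P k ≤-refl)
      ... | evenly k with () ← trans (sym o) (odd-2k k)
      sum≡ : A′ (m ∸ c) + A c ≡ A m
      sum≡ = trans (cong (λ z → A′ (m ∸ c) + A z) (sym (m∸[m∸n]≡n c≤m))) (reversed-prefix m st (m ∸ c) (m∸n≤m m c))
      floor : ∀ {u} i → (∀ k → k * 2 ≤ i → k * 2 ≤ prefix u (k * 2)) → ∃ λ k → k * 2 ≤ prefix u i × (i ≡ k * 2 ⊎ i ≡ suc (k * 2))
      floor {u} i b with parity i
      ... | evenly k = k , b k ≤-refl , inj₁ refl
      ... | oddly k  = k , ≤-trans (b k (n≤1+n _)) (prefix-mono u (n≤1+n _)) , inj₂ refl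
      r : m ≤ suc (A m)
      r with floor c (λ k l → K.blocks k (≤-trans l c≤m) (λ j p → f j (<-≤-trans p l)))
           | floor (m ∸ c) (λ k l → K′.blocks k (≤-trans l (m∸n≤m m c)) (λ j p → f′ j (<-≤-trans p l)))
      ... | k , a , d | l , b , e = subst (λ z → m ≤ suc z) sum≡ (≤-trans (lengths d e) (s≤s (b ⊕ a)))
        where
        two : ∀ l k → suc (l * 2) + suc (k * 2) ≡ suc (l + k) * 2
        two = solve-∀
        lengths : c ≡ k * 2 ⊎ c ≡ suc (k * 2) → m ∸ c ≡ l * 2 ⊎ m ∸ c ≡ suc (l * 2) → m ≤ suc (l * 2 + k * 2)
        lengths (inj₁ d) (inj₁ e) = ≤-trans (≤-reflexive (trans (sym (m∸n+n≡m c≤m)) (cong₂ _+_ e d))) (n≤1+n _)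
        lengths (inj₁ d) (inj₂ e) = ≤-reflexive (trans (sym (m∸n+n≡m c≤m)) (cong₂ _+_ e d))
        lengths (inj₂ d) (inj₁ e) = ≤-reflexive (trans (sym (m∸n+n≡m c≤m)) (trans (cong₂ _+_ e d) (+-suc _ _)))
        lengths (inj₂ d) (inj₂ e) with () ← trans (sym o) (trans (cong odd (trans (sym (m∸n+n≡m c≤m)) (trans (cong₂ _+_ e d) (two l k)))) (odd-2k (suc (l + k))))

    -- The changes at both sides gain q + 1 each, in total n + 2; the middle stretch loses 4, which
    -- leaves the constant 2 of `Claim`.
    two-changes : ∀ c c′ → c′ ≤ m → c ≤ m ∸ c′ → c + c + suc q ≤ A c + A c + A c → c′ + c′ + suc q ≤ A′ c′ + A′ c′ + A′ c′ → Claim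
    two-changes c c′ c′≤m c≤d a b = linear 0 (a ⊕ b ⊕ K.stretch (d ∸ c) c (subst (_≤ m) (sym d≡) (m∸n≤m m c′)))
      (subst₂ (λ x y → A m + A m + A m + 2 + (c + c + suc q + (c′ + c′ + suc q) + (d ∸ c + (d ∸ c) + (A c + A c + A c)))
                     ≡ x + x + (q + q) + (A c + A c + A c + (A′ c′ + A′ c′ + A′ c′) + (A y + A y + A y + 4)) + 0)
        (trans (cong (_+ c′) d≡) (m∸n+n≡m c′≤m)) (sym d≡)
        (trans (cong (λ z → z + z + z + 2 + (c + c + suc q + (c′ + c′ + suc q) + (d ∸ c + (d ∸ c) + (A c + A c + A c)))) (sym (reversed-prefix m st c′ c′≤m)))
               (eq c c′ (d ∸ c) q (A c) (A d) (A′ c′))))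
      where
      d = m ∸ c′
      d≡ : d ∸ c + c ≡ d
      d≡ = m∸n+n≡m c≤d
      eq : ∀ c c′ e q a b a′ → a′ + b + (a′ + b) + (a′ + b) + 2 + (c + c + suc q + (c′ + c′ + suc q) + (e + e + (a + a + a)))
           ≡ e + c + c′ + (e + c + c′) + (q + q) + (a + a + a + (a′ + a′ + a′) + (b + b + b + 4)) + 0
      eq = solve-∀

  columns-bound : Claim
  columns-bound with K.scan m ≤-refl | K′.scan m ≤-refl
  ... | inj₁ f | _ = all-false f (parity m)
  -- Without a change seen from the right, all boundaries are of kind false if m is even, contrary
  -- to c; if m is odd, boundary 0 is of kind true, contrary to h 0 = 0.
  ... | inj₂ (c , c≤m , x , f) | inj₁ f′ = ⊥-elim (absurd (odd m) refl)
    where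
    absurd : ∀ b → odd m ≡ b → ⊥
    absurd false o = K.exclusive c (subst (K.Kind false) (m∸[m∸n]≡n c≤m)
      (subst (λ z → K.Kind (z xor false) (m ∸ (m ∸ c))) o (transfer false (m ∸ c) (m∸n≤m m c) (f′ (m ∸ c) (m∸n≤m m c))))) x
    absurd true o = n≮0 (subst (q <_) (Profile.first P) (subst (K.Kind true) (n∸n≡0 m)
      (subst (λ z → K.Kind (z xor false) (m ∸ m)) o (transfer false m ≤-refl (f′ m ≤-refl)))))
  ... | inj₂ (c , c≤m , x , f) | inj₂ (c′ , c′≤m , x′ , f′) with c ≤? m ∸ c′
  ...   | yes c≤d = two-changes c c′ c′≤m c≤d (K.first-change c c≤m x f) (K′.first-change c′ c′≤m x′ f′)
  -- The change found from the right lies before c, where all boundaries are of kind false; for even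
  -- m it would be of kind true.
  ...   | no  c≰d = one-change c c≤m f (λ j l → f′ j (≤-trans l m∸c≤c′)) (odd-m (odd m) refl)
    where
    d<c : m ∸ c′ < c
    d<c = ≰⇒> c≰d
    m∸c≤c′ : m ∸ c ≤ c′
    m∸c≤c′ = ≤-trans (∸-monoʳ-≤ m (<⇒≤ d<c)) (≤-reflexive (m∸[m∸n]≡n c′≤m))
    odd-m : ∀ b → odd m ≡ b → odd m ≡ true
    odd-m true  o = o
    odd-m false o = ⊥-elim (K.exclusive (m ∸ c′) (f (m ∸ c′) d<c) (subst (λ z → K.Kind (z xor true) (m ∸ c′)) o (transfer true c′ c′≤m x′)))

-- Edge sets

∣m+n∣n⇒∣m : ∀ {i m n} → i ∣ m + n → i ∣ n → i ∣ m
∣m+n∣n⇒∣m {i} {m} {n} p = ∣m+n∣m⇒∣n (subst (i ∣_) (+-comm m n) p)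

Σ<-+ : ∀ n f g → Σ< n (λ i → f i + g i) ≡ Σ< n f + Σ< n g
Σ<-+ zero    f g = refl
Σ<-+ (suc n) f g = trans (cong (f 0 + g 0 +_) (Σ<-+ n (f ∘ suc) (g ∘ suc))) (eq (f 0) (g 0) _ _)
  where
  eq : ∀ a b c d → a + b + (c + d) ≡ a + c + (b + d)
  eq = solve-∀

Σ<-const : ∀ n c → Σ< n (λ _ → c) ≡ n * c
Σ<-const zero    c = refl
Σ<-const (suc n) c = cong (c +_) (Σ<-const n c)

Σ<-mono : ∀ n {f g} → (∀ i → i < n → f i ≤ g i) → Σ< n f ≤ Σ< n g
Σ<-mono zero    e = z≤n
Σ<-mono (suc n) e = +-mono-≤ (e 0 (s≤s z≤n)) (Σ<-mono n (λ i p → e (suc i) (s≤s p)))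

Σ<-∣ : ∀ n {f k} → (∀ i → i < n → k ∣ f i) → k ∣ Σ< n f
Σ<-∣ zero    e = _ ∣0
Σ<-∣ (suc n) e = ∣m∣n⇒∣m+n (e 0 (s≤s z≤n)) (Σ<-∣ n (λ i p → e (suc i) (s≤s p)))

Σ<-zero : ∀ n {f} → Σ< n f ≡ 0 → ∀ i → i < n → f i ≡ 0
Σ<-zero (suc n) {f} e zero    p       = m+n≡0⇒m≡0 (f 0) e
Σ<-zero (suc n) {f} e (suc i) (s≤s p) = Σ<-zero n (m+n≡0⇒n≡0 (f 0) e) i p

Σ<-pairs : ∀ q f → (∀ k → k < q → f (k * 2) + f (suc (k * 2)) ≤ 1) → Σ< (q * 2) f ≤ q
Σ<-pairs zero    f e = z≤n
Σ<-pairs (suc q) f e = ≤-trans (≤-reflexive (sym (+-assoc (f 0) (f 1) _)))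
  (+-mono-≤ (e 0 (s≤s z≤n)) (Σ<-pairs q (λ i → f (2 + i)) (λ k p → e (suc k) (s≤s p))))

-- H x y and V x y are 1 or 0 according to whether the cell (x , y) is joined to its left, respectively lower, neighbour.
record Edges (m n : ℕ) (H V : ℕ → ℕ → ℕ) : Set where
  field
    left     : ∀ y → H 0 y ≡ 0
    right    : ∀ y → H m y ≡ 0
    bottom   : ∀ x → V x 0 ≡ 0
    top      : ∀ x → V x n ≡ 0
    H≤1      : ∀ x y → H x y ≤ 1
    degree   : ∀ x y → x < m → y < n → H x y + H (suc x) y + (V x y + V x (suc y)) ≡ 2
    noSquare : ∀ x y → suc x < m → suc y < n → V x (suc y) ≡ 1 → V (suc x) (suc y) ≡ 1 →
               H (suc x) y ≡ 1 → H (suc x) (suc y) ≡ 1 → ⊥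

-- A turn has exactly one horizontal edge, a straight cell none or two.
straight : (ℕ → ℕ → ℕ) → ℕ → ℕ → ℕ
straight H x y = ∣ H x y + H (suc x) y - 1 ∣

crossings straightsIn : ℕ → (ℕ → ℕ → ℕ) → ℕ → ℕ
crossings   n H i = Σ< n (H i)
straightsIn n H i = Σ< n (straight H i)

module _ {m n H V} (E : Edges m n H V) where
  open Edges E
  private
    h  = crossings n H
    st = straightsIn n H

    a≤1+∣a-1∣ : ∀ a → a ≤ 1 + ∣ a - 1 ∣
    a≤1+∣a-1∣ zero    = z≤n
    a≤1+∣a-1∣ (suc a) = s≤s (≤-reflexive (sym (∣-∣-identityʳ a)))

    1≤a+∣a-1∣ : ∀ a → 1 ≤ a + ∣ a - 1 ∣
    1≤a+∣a-1∣ zero    = ≤-refl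
    1≤a+∣a-1∣ (suc a) = s≤s z≤n

    even-∣a-1∣ : ∀ a → 2 ∣ ∣ a - 1 ∣ + (a + 1)
    even-∣a-1∣ zero    = divides 1 refl
    even-∣a-1∣ (suc a) = divides (suc a) (trans (cong (_+ suc (a + 1)) (∣-∣-identityʳ a)) (eq a))
      where
      eq : ∀ a → a + suc (a + 1) ≡ suc a * 2
      eq = solve-∀

    h+h : ∀ i → h i + h (suc i) ≡ Σ< n (λ y → H i y + H (suc i) y)
    h+h i = sym (Σ<-+ n (H i) (H (suc i)))

    n≡Σ : n ≡ Σ< n (λ _ → 1)
    n≡Σ = sym (trans (Σ<-const n 1) (*-identityʳ n))

  crossings-upper : ∀ i → h i + h (suc i) ≤ n + st i
  crossings-upper i = begin
    h i + h (suc i)                                ≡⟨ h+h i ⟩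
    Σ< n (λ y → H i y + H (suc i) y)               ≤⟨ Σ<-mono n (λ y _ → a≤1+∣a-1∣ (H i y + H (suc i) y)) ⟩
    Σ< n (λ y → 1 + straight H i y)                ≡⟨ Σ<-+ n (λ _ → 1) (straight H i) ⟩
    Σ< n (λ _ → 1) + st i                          ≡⟨ cong (_+ st i) (sym n≡Σ) ⟩
    n + st i ∎
    where open ≤-Reasoning

  crossings-lower : ∀ i → n ≤ h i + h (suc i) + st i
  crossings-lower i = begin
    n                                              ≡⟨ n≡Σ ⟩
    Σ< n (λ _ → 1)                                 ≤⟨ Σ<-mono n (λ y _ → 1≤a+∣a-1∣ (H i y + H (suc i) y)) ⟩
    Σ< n (λ y → H i y + H (suc i) y + straight H i y) ≡⟨ Σ<-+ n (λ y → H i y + H (suc i) y) (straight H i) ⟩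
    Σ< n (λ y → H i y + H (suc i) y) + st i        ≡⟨ cong (_+ st i) (sym (h+h i)) ⟩
    h i + h (suc i) + st i ∎
    where open ≤-Reasoning

  -- The degrees in a column sum to an even number, and its vertical edges are counted twice.
  crossings-even-step : ∀ i → i < m → 2 ∣ h i + h (suc i)
  crossings-even-step i p = ∣m+n∣n⇒∣m (subst (2 ∣_) total (n∣m*n n)) (divides (Σ< n (V i)) twice)
    where
    up : Σ< n (λ y → V i (suc y)) ≡ Σ< n (V i)
    up = trans (cong (_+ Σ< n (λ y → V i (suc y))) (sym (bottom i)))
         (trans (Σ<-last n (V i)) (trans (cong (Σ< n (V i) +_) (top i)) (+-identityʳ _)))
    twice : Σ< n (V i) + Σ< n (λ y → V i (suc y)) ≡ Σ< n (V i) * 2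
    twice = trans (cong (Σ< n (V i) +_) up) (eq (Σ< n (V i)))
      where
      eq : ∀ a → a + a ≡ a * 2
      eq = solve-∀
    total : n * 2 ≡ h i + h (suc i) + (Σ< n (V i) + Σ< n (λ y → V i (suc y)))
    total = begin
      n * 2                                        ≡⟨ sym (Σ<-const n 2) ⟩
      Σ< n (λ _ → 2)                               ≡⟨ Σ<-cong n (λ y q → sym (degree i y p q)) ⟩
      Σ< n (λ y → H i y + H (suc i) y + (V i y + V i (suc y)))
        ≡⟨ Σ<-+ n (λ y → H i y + H (suc i) y) (λ y → V i y + V i (suc y)) ⟩
      Σ< n (λ y → H i y + H (suc i) y) + Σ< n (λ y → V i y + V i (suc y))
        ≡⟨ cong₂ _+_ (sym (h+h i)) (Σ<-+ n (V i) (V i ∘ suc)) ⟩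
      h i + h (suc i) + (Σ< n (V i) + Σ< n (λ y → V i (suc y))) ∎
      where open ≡-Reasoning

  crossings-first : h 0 ≡ 0
  crossings-first = trans (Σ<-cong n (λ y _ → left y)) (trans (Σ<-const n 0) (*-zeroʳ n))

  crossings-last : h m ≡ 0
  crossings-last = trans (Σ<-cong n (λ y _ → right y)) (trans (Σ<-const n 0) (*-zeroʳ n))

  crossings-even : ∀ i → i ≤ m → 2 ∣ h i
  crossings-even zero    _ = subst (2 ∣_) (sym crossings-first) (2 ∣0)
  crossings-even (suc i) p = ∣m+n∣m⇒∣n (crossings-even-step i p) (crossings-even i (<⇒≤ p))

  -- Modulo 2, |a - 1| equals a + 1, and the numbers a of horizontal edges at the cells of a column
  -- have an even sum.
  straights-parity : ∀ i → i < m → 2 ∣ st i + n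
  straights-parity i p = ∣m+n∣m⇒∣n (subst (2 ∣_) total (Σ<-∣ n (λ y _ → even-∣a-1∣ (H i y + H (suc i) y)))) (crossings-even-step i p)
    where
    total : Σ< n (λ y → straight H i y + (H i y + H (suc i) y + 1)) ≡ h i + h (suc i) + (st i + n)
    total = begin
      Σ< n (λ y → straight H i y + (H i y + H (suc i) y + 1)) ≡⟨ Σ<-+ n (straight H i) (λ y → H i y + H (suc i) y + 1) ⟩
      st i + Σ< n (λ y → H i y + H (suc i) y + 1)   ≡⟨ cong (st i +_) (Σ<-+ n (λ y → H i y + H (suc i) y) (λ _ → 1)) ⟩
      st i + (Σ< n (λ y → H i y + H (suc i) y) + Σ< n (λ _ → 1)) ≡⟨ cong₂ (λ a b → st i + (a + b)) (sym (h+h i)) (sym n≡Σ) ⟩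
      st i + (h i + h (suc i) + n)                  ≡⟨ eq (st i) (h i + h (suc i)) n ⟩
      h i + h (suc i) + (st i + n) ∎
      where
      open ≡-Reasoning
      eq : ∀ a b c → a + (b + c) ≡ b + (a + c)
      eq = solve-∀

  -- In a column without straight cells every cell has one vertical edge, so the vertical edges are forced from the bottom up.
  free-column : ∀ i → i < m → st i ≡ 0 → ∀ k → k * 2 < n → V i (k * 2) ≡ 0 × V i (suc (k * 2)) ≡ 1
  free-column i p free = go
    where
    one-vertical : ∀ y → y < n → V i y + V i (suc y) ≡ 1
    one-vertical y q = suc-injective (trans (cong (_+ (V i y + V i (suc y))) (sym (∣m-n∣≡0⇒m≡n {H i y + H (suc i) y} {1} (Σ<-zero n free y q)))) (degree i y p q))
    go : ∀ k → k * 2 < n → V i (k * 2) ≡ 0 × V i (suc (k * 2)) ≡ 1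
    go zero    q = bottom i , trans (cong (_+ V i 1) (sym (bottom i))) (one-vertical 0 q)
    go (suc k) q = z , trans (cong (_+ V i (3 + k * 2)) (sym z)) (one-vertical (2 + k * 2) q)
      where
      z : V i (2 + k * 2) ≡ 0
      z = suc-injective (trans (cong (_+ V i (2 + k * 2)) (sym (proj₂ (go k (<⇒≤ (<⇒≤ q)))))) (one-vertical (suc (k * 2)) (<⇒≤ q)))

  -- The forced vertical edges join rows 2k and 2k + 1 in both columns; horizontal edges in both
  -- these rows would complete a unit square.
  free-pair : ∀ q → n ≡ q * 2 → ∀ i → suc i < m → st i ≡ 0 → st (suc i) ≡ 0 → h (suc i) ≤ q
  free-pair q refl i p f g = Σ<-pairs q (H (suc i)) λ k l → at-most-one k l (H≤1 (suc i) (k * 2)) (H≤1 (suc i) (suc (k * 2)))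
    where
    at-most-one : ∀ k → k < q → H (suc i) (k * 2) ≤ 1 → H (suc i) (suc (k * 2)) ≤ 1 → H (suc i) (k * 2) + H (suc i) (suc (k * 2)) ≤ 1
    at-most-one k l a b with H (suc i) (k * 2) in e | H (suc i) (suc (k * 2)) in e′
    ... | 0 | 0 = z≤n
    ... | 0 | 1 = ≤-refl
    ... | 1 | 0 = ≤-refl
    ... | 1 | 1 = ⊥-elim (noSquare i (k * 2) p (*-monoˡ-≤ 2 l)
      (proj₂ (free-column i (<⇒≤ p) f k (*-monoˡ-< 2 l))) (proj₂ (free-column (suc i) p g k (*-monoˡ-< 2 l))) e e′)
    at-most-one k l (s≤s ()) b | suc (suc _) | _
    at-most-one k l a (s≤s ()) | _ | suc (suc _)

  profile : ∀ q → n ≡ q * 2 → Profile m q h st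
  profile q e = record
    { first = crossings-first ; last = crossings-last
    ; upper = λ i _ → subst (λ z → h i + h (suc i) ≤ z + st i) n≡ (crossings-upper i)
    ; lower = λ i _ → subst (_≤ h i + h (suc i) + st i) n≡ (crossings-lower i)
    ; pair  = free-pair q e
    ; evenH = crossings-even
    ; evenS = λ i p → ∣m+n∣n⇒∣m (straights-parity i p) (divides q e) }
    where
    n≡ : n ≡ q + q
    n≡ = trans e (eq q)
      where
      eq : ∀ q → q * 2 ≡ q + q
      eq = solve-∀

  odd-rows-bound : ¬ (2 ∣ n) → ∀ i → i ≤ m → i ≤ prefix st i
  odd-rows-bound odd zero    _ = z≤n
  odd-rows-bound odd (suc i) p = subst (_≤ prefix st (suc i)) (+-comm i 1) (+-mono-≤ (odd-rows-bound odd i (<⇒≤ p)) (positive (st i) refl))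
    where
    positive : ∀ s → s ≡ st i → 1 ≤ s
    positive zero    e = ⊥-elim (odd (subst (λ z → 2 ∣ z + n) (sym e) (straights-parity i p)))
    positive (suc s) e = s≤s z≤n

-- The edge set of a Hamilton cycle

indicator : ∀ {A : Set} → Dec A → ℕ
indicator (yes _) = 1
indicator (no _)  = 0

indicator-yes : ∀ {A : Set} (d : Dec A) → A → indicator d ≡ 1
indicator-yes (yes _) _ = refl
indicator-yes (no ¬a) a = ⊥-elim (¬a a)

indicator-no : ∀ {A : Set} (d : Dec A) → ¬ A → indicator d ≡ 0
indicator-no (yes a) ¬a = ⊥-elim (¬a a)
indicator-no (no _)  _  = refl

indicator-1 : ∀ {A : Set} (d : Dec A) → indicator d ≡ 1 → A
indicator-1 (yes a) _ = a

indicator-≤1 : ∀ {A : Set} (d : Dec A) → indicator d ≤ 1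
indicator-≤1 (yes _) = ≤-refl
indicator-≤1 (no _)  = z≤n

δ : Pt → Pt → ℕ
δ p c = indicator (p ≟ₚ c)

δ-refl : ∀ p → δ p p ≡ 1
δ-refl p = indicator-yes (p ≟ₚ p) refl

δ-≢ : ∀ {p c} → p ≢ c → δ p c ≡ 0
δ-≢ {p} {c} = indicator-no (p ≟ₚ c)

data Nbr : Bool → Pt → Pt → Set where
  leftward  : ∀ {x y} → Nbr true (suc x , y) (x , y)
  rightward : ∀ {x y} → Nbr true (x , y) (suc x , y)
  downward  : ∀ {x y} → Nbr false (x , suc y) (x , y)
  upward    : ∀ {x y} → Nbr false (x , y) (x , suc y)

unit-distance : ∀ x z → ∣ x - z ∣ ≡ 1 → x ≡ suc z ⊎ z ≡ suc x
unit-distance zero    (suc zero) refl = inj₂ refl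
unit-distance (suc zero) zero    refl = inj₁ refl
unit-distance (suc x) (suc z)    e with unit-distance x z e
... | inj₁ p = inj₁ (cong suc p)
... | inj₂ p = inj₂ (cong suc p)

nbr : ∀ p c → Adj p c → ∃ λ b → Nbr b p c
nbr (x , y) (x′ , y′) e with ∣ x - x′ ∣ in p
... | zero with refl ← ∣m-n∣≡0⇒m≡n {x} {x′} p with unit-distance y y′ e
...   | inj₁ refl = false , downward
...   | inj₂ refl = false , upward
nbr (x , y) (x′ , y′) e | suc k with refl ← ∣m-n∣≡0⇒m≡n {y} {y′} (m+n≡0⇒n≡0 k (suc-injective e))
                              | unit-distance x x′ (trans p (cong suc (m+n≡0⇒m≡0 k (suc-injective e))))
... | inj₁ refl = true , leftward
... | inj₂ refl = true , rightward

toLeft toDown : Pt → Pt → ℕ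
toLeft (zero  , y) c = 0
toLeft (suc x , y) c = δ (x , y) c
toDown (x , zero)  c = 0
toDown (x , suc y) c = δ (x , y) c

-- For a neighbour c of p exactly one of the two is 1: `across` if the edge is horizontal, `along`
-- if it is vertical.
across along : Pt → Pt → ℕ
across p c = toLeft p c + δ (suc (proj₁ p) , proj₂ p) c
along  p c = toDown p c + δ (proj₁ p , suc (proj₂ p)) c

bit : Bool → ℕ
bit true  = 1
bit false = 0

toLeft-≢ : ∀ {x y c} → (∀ {x′} → x ≡ suc x′ → (x′ , y) ≢ c) → toLeft (x , y) c ≡ 0
toLeft-≢ {zero}  ne = refl
toLeft-≢ {suc x} ne = δ-≢ (ne refl)

toDown-≢ : ∀ {x y c} → (∀ {y′} → y ≡ suc y′ → (x , y′) ≢ c) → toDown (x , y) c ≡ 0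
toDown-≢ {y = zero}  ne = refl
toDown-≢ {y = suc y} ne = δ-≢ (ne refl)

across-nbr : ∀ {b p c} → Nbr b p c → across p c ≡ bit b
across-nbr (leftward {x} {y})  = cong₂ _+_ (δ-refl (x , y)) (δ-≢ (λ ()))
across-nbr (rightward {x} {y}) = cong₂ _+_ (toLeft-≢ {x} λ { refl () }) (δ-refl (suc x , y))
across-nbr (downward {x} {y})  = cong₂ _+_ (toLeft-≢ {x} λ { refl () }) (δ-≢ (λ ()))
across-nbr (upward {x} {y})    = cong₂ _+_ (toLeft-≢ {x} λ { refl () }) (δ-≢ (λ ()))

along-nbr : ∀ {b p c} → Nbr b p c → bit b + along p c ≡ 1
along-nbr (leftward {x} {y})  = cong suc (cong₂ _+_ (toDown-≢ {y = y} λ { refl () }) (δ-≢ (λ ())))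
along-nbr (rightward {x} {y}) = cong suc (cong₂ _+_ (toDown-≢ {y = y} λ { refl () }) (δ-≢ (λ ())))
along-nbr (downward {x} {y})  = cong₂ _+_ (δ-refl (x , y)) (δ-≢ (λ ()))
along-nbr (upward {x} {y})    = cong₂ _+_ (toDown-≢ {y = y} λ { refl () }) (δ-refl (x , suc y))

prevF-nextF : ∀ {N} (i : Fin N) → prevF (nextF i) ≡ i
prevF-nextF i with next-spec i | prev-spec (nextF i)
... | inj₁ p       | inj₁ q       = toℕ-injective (suc-injective (trans (sym q) p))
... | inj₁ p       | inj₂ (q , _) with () ← trans (sym q) p
... | inj₂ (p , _) | inj₁ q       with () ← trans (sym p) q
... | inj₂ (_ , p) | inj₂ (_ , q) = toℕ-injective (suc-injective (trans q (sym p)))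

prevF≢nextF : ∀ {N} → 2 < N → (i : Fin N) → prevF i ≢ nextF i
prevF≢nextF 2<N i e with prev-spec i | next-spec i
... | inj₁ p       | inj₁ q       = 1+n≰n (≤-trans (n≤1+n _) (≤-reflexive (sym (trans (cong toℕ e) (trans q (cong suc p))))))
... | inj₁ p       | inj₂ (q , r) = <-irrefl (sym (trans (sym r) (cong suc (trans p (cong suc (trans (cong toℕ e) q)))))) 2<N
... | inj₂ (p , r) | inj₁ q       = <-irrefl (sym (trans (sym r) (cong suc (trans (cong toℕ e) (trans q (cong suc p)))))) 2<N
... | inj₂ (p , r) | inj₂ (q , s) = <-irrefl (sym (trans (sym s) (cong suc p))) (<-trans (s≤s (s≤s z≤n)) 2<N)

-- From i the successor runs up to the last index, wraps around to 0 and from there reaches every j.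
closed⇒all : ∀ {N} {Q : Fin N → Set} → (∀ i → Q i → Q (nextF i)) → ∀ i → Q i → ∀ j → Q j
closed⇒all {suc N} {Q} step i q j = ascend zero (toℕ j) j (+-identityʳ (toℕ j)) at-zero
  where
  ascend : ∀ a k b → k + toℕ a ≡ toℕ b → Q a → Q b
  ascend a zero    b e r = subst Q (toℕ-injective e) r
  ascend a (suc k) b e r with next-spec a
  ... | inj₁ p       = ascend (nextF a) k b (trans (cong (k +_) p) (trans (+-suc k (toℕ a)) e)) (step a r)
  ... | inj₂ (_ , p) = ⊥-elim (<⇒≱ (toℕ<n b) (≤-trans (≤-reflexive (sym p)) (≤-trans (s≤s (m≤n+m (toℕ a) k)) (≤-reflexive e))))
  last : Fin (suc N)
  last = fromℕ N
  at-last : Q last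
  at-last = ascend i (N ∸ toℕ i) last (trans (m∸n+n≡m (≤-pred (toℕ<n i))) (sym (toℕ-fromℕ N))) q
  at-zero : Q zero
  at-zero with next-spec last
  ... | inj₂ (p , _) = subst Q (toℕ-injective p) (step last at-last)
  ... | inj₁ p       = ⊥-elim (<-irrefl (trans p (cong suc (toℕ-fromℕ N))) (toℕ<n (nextF last)))

count-exact : ∀ {A : Set} {P : A → Set} (P? : Decidable P) (g : A → ℕ) N (f : Fin N → A) →
              (∀ i → P (f i) × g (f i) ≡ 0 ⊎ ¬ P (f i) × g (f i) ≡ 1) →
              length (filter P? (tabulate f)) + sum (map g (tabulate f)) ≡ N
count-exact P? g zero    f h = refl
count-exact P? g (suc N) f h with P? (f zero) | h zero
... | yes p | inj₁ (_ , e)  = cong suc (trans (cong (λ z → length (filter P? (tabulate (f ∘ suc))) + (z + sum (map g (tabulate (f ∘ suc))))) e)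
                              (count-exact P? g N (f ∘ suc) (h ∘ suc)))
... | yes p | inj₂ (¬p , _) = ⊥-elim (¬p p)
... | no ¬p | inj₁ (p , _)  = ⊥-elim (¬p p)
... | no ¬p | inj₂ (_ , e)  = trans (cong (λ z → length (filter P? (tabulate (f ∘ suc))) + (z + sum (map g (tabulate (f ∘ suc))))) e)
                              (trans (+-suc _ _) (cong suc (count-exact P? g N (f ∘ suc) (h ∘ suc))))

sum-tabulate : ∀ n (G : ℕ → ℕ) → sum (tabulate {n = n} (G ∘ toℕ)) ≡ Σ< n G
sum-tabulate zero    G = refl
sum-tabulate (suc n) G = cong (G 0 +_) (sum-tabulate n (G ∘ suc))

sum-allFin : ∀ n (G : ℕ → ℕ) → sum (map (G ∘ toℕ) (allFin n)) ≡ Σ< n G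
sum-allFin n G = trans (cong sum (map-tabulate {n = n} id (G ∘ toℕ))) (sum-tabulate n G)

sum-cartesian : ∀ {A B : Set} (g : A × B → ℕ) xs (ys : List B) →
                sum (map g (cartesianProduct xs ys)) ≡ sum (map (λ x → sum (map (λ y → g (x , y)) ys)) xs)
sum-cartesian g []       ys = refl
sum-cartesian g (x ∷ xs) ys = begin
  sum (map g (map (x ,_) ys ++ cartesianProduct xs ys))                 ≡⟨ cong sum (map-++ g (map (x ,_) ys) _) ⟩
  sum (map g (map (x ,_) ys) ++ map g (cartesianProduct xs ys))         ≡⟨ sum-++ (map g (map (x ,_) ys)) _ ⟩
  sum (map g (map (x ,_) ys)) + sum (map g (cartesianProduct xs ys))    ≡⟨ cong₂ _+_ (cong sum (sym (map-∘ ys))) (sum-cartesian g xs ys) ⟩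
  sum (map (λ y → g (x , y)) ys) + sum (map (λ x → sum (map (λ y → g (x , y)) ys)) xs) ∎
  where open ≡-Reasoning

Σ<-prefix : ∀ n f → Σ< n f ≡ prefix f n
Σ<-prefix zero    f = refl
Σ<-prefix (suc n) f = trans (Σ<-last n f) (cong (_+ f n) (Σ<-prefix n f))

module Config {m n} (C : HamCycle m n) (2<m : 2 < m) (0<n : 0 < n) where
  private
    N = m * n
    2<N : 2 < N
    2<N = ≤-trans 2<m (subst (_≤ m * n) (*-identityʳ m) (*-monoʳ-≤ m 0<n))

  pt : Fin N → Pt
  pt i = toPt (cell C i)

  pt-injective : ∀ {i j} → pt i ≡ pt j → i ≡ j
  pt-injective e = inj C (toPt-injective e)

  Joined : Pt → Pt → Set
  Joined p c = ∃ λ i → (pt i ≡ p × pt (nextF i) ≡ c) ⊎ (pt i ≡ c × pt (nextF i) ≡ p)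

  joined? : ∀ p c → Dec (Joined p c)
  joined? p c = any? λ i → ((pt i ≟ₚ p) ×-dec (pt (nextF i) ≟ₚ c)) ⊎-dec ((pt i ≟ₚ c) ×-dec (pt (nextF i) ≟ₚ p))

  joined : Pt → Pt → ℕ
  joined p c = indicator (joined? p c)

  joined-sym : ∀ p c → joined p c ≡ joined c p
  joined-sym p c with joined? p c
  ... | yes (i , e) = sym (indicator-yes (joined? c p) (i , swap e))
  ... | no ¬e       = sym (indicator-no (joined? c p) λ (i , e) → ¬e (i , swap e))

  joined⇒ : ∀ {j c} → Joined (pt j) c → c ≡ pt (prevF j) ⊎ c ≡ pt (nextF j)
  joined⇒ (i , inj₁ (e , refl)) with refl ← pt-injective e = inj₂ refl
  joined⇒ (i , inj₂ (refl , e)) with refl ← pt-injective e = inj₁ (cong pt (sym (prevF-nextF i)))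

  prev≢next : ∀ j → pt (prevF j) ≢ pt (nextF j)
  prev≢next j e = prevF≢nextF 2<N j (pt-injective e)

  -- The two summands are never both 1, because the cycle has more than two cells.
  joined≡ : ∀ j c → joined (pt j) c ≡ δ c (pt (prevF j)) + δ c (pt (nextF j))
  joined≡ j c with c ≟ₚ pt (prevF j) | c ≟ₚ pt (nextF j)
  ... | yes refl | yes e    = ⊥-elim (prev≢next j e)
  ... | yes refl | no _     = indicator-yes (joined? _ _) (prevF j , inj₂ (refl , cong pt (nextF-prevF j)))
  ... | no _     | yes refl = indicator-yes (joined? _ _) (j , inj₁ (refl , refl))
  ... | no ¬a    | no ¬b    = indicator-no (joined? _ _) λ z → [ ¬a , ¬b ] (joined⇒ z)

  H V : ℕ → ℕ → ℕ
  H zero    y = 0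
  H (suc x) y = joined (x , y) (suc x , y)
  V x zero    = 0
  V x (suc y) = joined (x , y) (x , suc y)

  private
    interchange : ∀ a b c d → a + b + (c + d) ≡ a + c + (b + d)
    interchange = solve-∀

  module At (j : Fin N) where
    x = proj₁ (pt j)
    y = proj₂ (pt j)
    a = pt (prevF j)
    b = pt (nextF j)

    H-left : ∀ {x y} → pt j ≡ (x , y) → H x y ≡ toLeft (x , y) a + toLeft (x , y) b
    H-left {zero}      e = refl
    H-left {suc x} {y} e = trans (joined-sym (x , y) (suc x , y)) (trans (cong (λ z → joined z (x , y)) (sym e)) (joined≡ j (x , y)))

    V-down : ∀ {x y} → pt j ≡ (x , y) → V x y ≡ toDown (x , y) a + toDown (x , y) b
    V-down {x} {zero}  e = refl
    V-down {x} {suc y} e = trans (joined-sym (x , y) (x , suc y)) (trans (cong (λ z → joined z (x , y)) (sym e)) (joined≡ j (x , y)))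

    H-sum : H x y + H (suc x) y ≡ across (pt j) a + across (pt j) b
    H-sum = trans (cong₂ _+_ (H-left refl) (joined≡ j (suc x , y))) (interchange (toLeft (pt j) a) _ _ _)

    V-sum : V x y + V x (suc y) ≡ along (pt j) a + along (pt j) b
    V-sum = trans (cong₂ _+_ (V-down refl) (joined≡ j (x , suc y))) (interchange (toDown (pt j) a) _ _ _)

    Adj-sym : ∀ p c → Adj p c → Adj c p
    Adj-sym (x , y) (x′ , y′) e = trans (cong₂ _+_ (∣-∣-comm x′ x) (∣-∣-comm y′ y)) e

    nbr-a : ∃ λ β → Nbr β (pt j) a
    nbr-a = nbr (pt j) a (Adj-sym a (pt j) (subst (λ z → Adj a (pt z)) (nextF-prevF j) (adj C (prevF j))))

    nbr-b : ∃ λ β → Nbr β (pt j) b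
    nbr-b = nbr (pt j) b (adj C j)

    degree-at : H x y + H (suc x) y + (V x y + V x (suc y)) ≡ 2
    degree-at = begin
      H x y + H (suc x) y + (V x y + V x (suc y))                                    ≡⟨ cong₂ _+_ H-sum V-sum ⟩
      across (pt j) a + across (pt j) b + (along (pt j) a + along (pt j) b)          ≡⟨ interchange (across (pt j) a) _ _ _ ⟩
      across (pt j) a + along (pt j) a + (across (pt j) b + along (pt j) b)          ≡⟨ cong₂ _+_ (one nbr-a) (one nbr-b) ⟩
      2 ∎
      where
      open ≡-Reasoning
      one : ∀ {c} → (∃ λ β → Nbr β (pt j) c) → across (pt j) c + along (pt j) c ≡ 1
      one {c} (_ , r) = trans (cong (_+ along (pt j) c) (across-nbr r)) (along-nbr r)

    straight≡ : straight H x y ≡ ∣ bit (proj₁ nbr-a) + bit (proj₁ nbr-b) - 1 ∣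
    straight≡ = cong (λ z → ∣ z - 1 ∣) (trans H-sum (cong₂ _+_ (across-nbr (proj₂ nbr-a)) (across-nbr (proj₂ nbr-b))))

    same-row : ∀ {p c} → Nbr true p c → proj₂ c ≡ proj₂ p × proj₁ c ≢ proj₁ p
    same-row leftward  = refl , λ ()
    same-row rightward = refl , λ ()

    same-column : ∀ {p c} → Nbr false p c → proj₁ c ≡ proj₁ p × proj₂ c ≢ proj₂ p
    same-column downward = refl , λ ()
    same-column upward   = refl , λ ()

    turn-or-straight : IsTurn C j × straight H x y ≡ 0 ⊎ ¬ IsTurn C j × straight H x y ≡ 1
    turn-or-straight with nbr-a | nbr-b | straight≡
    ... | true  , r | false , s | e = inj₁ (inj₁ (toℕ-injective (proj₁ (same-row r)) , toℕ-injective (sym (proj₁ (same-column s)))) , e)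
    ... | false , r | true  , s | e = inj₁ (inj₂ (toℕ-injective (proj₁ (same-column r)) , toℕ-injective (sym (proj₁ (same-row s)))) , e)
    ... | true  , r | true  , s | e = inj₂ ((λ { (inj₁ (_ , v)) → proj₂ (same-row s) (cong toℕ (sym v)) ; (inj₂ (v , _)) → proj₂ (same-row r) (cong toℕ v) }) , e)
    ... | false , r | false , s | e = inj₂ ((λ { (inj₁ (v , _)) → proj₂ (same-column r) (cong toℕ v) ; (inj₂ (_ , v)) → proj₂ (same-column s) (cong toℕ (sym v)) }) , e)

  index : ∀ x y → x < m → y < n → ∃ λ j → pt j ≡ (x , y)
  index x y p q = let j , e = surj C (fromℕ< p , fromℕ< q) in
    j , trans (cong toPt (e refl)) (cong₂ _,_ (toℕ-fromℕ< p) (toℕ-fromℕ< q))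

  -- Each corner of such a square would have both its neighbours among the corners, so the cycle
  -- could never leave the square; yet it visits a third column.
  noSquare : ∀ x y → V x (suc y) ≡ 1 → V (suc x) (suc y) ≡ 1 → H (suc x) y ≡ 1 → H (suc x) (suc y) ≡ 1 → ⊥
  noSquare x y vl vr hb ht = outside (other x)
    where
    InSquare : Pt → Set
    InSquare c = (c ≡ (x , y) ⊎ c ≡ (suc x , y)) ⊎ (c ≡ (x , suc y) ⊎ c ≡ (suc x , suc y))

    edge : ∀ {p c} → joined p c ≡ 1 → Joined p c
    edge {p} {c} = indicator-1 (joined? p c)

    flip : ∀ {p c} → Joined p c → Joined c p
    flip (i , e) = i , swap e

    forced : ∀ {j p c d} → pt j ≡ p → Joined p c → Joined p d → c ≢ d → pt (nextF j) ≡ c ⊎ pt (nextF j) ≡ d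
    forced {j} refl r s ne with joined⇒ r | joined⇒ s
    ... | inj₂ e    | _         = inj₁ (sym e)
    ... | inj₁ _    | inj₂ e    = inj₂ (sym e)
    ... | inj₁ refl | inj₁ e    = ⊥-elim (ne (sym e))

    bl-br = edge hb
    tl-tr = edge ht
    bl-tl = edge vl
    br-tr = edge vr

    stays : ∀ j → InSquare (pt j) → InSquare (pt (nextF j))
    stays j (inj₁ (inj₁ e)) with forced e bl-br bl-tl (λ ())
    ... | inj₁ r = inj₁ (inj₂ r)
    ... | inj₂ r = inj₂ (inj₁ r)
    stays j (inj₁ (inj₂ e)) with forced e (flip bl-br) br-tr (λ ())
    ... | inj₁ r = inj₁ (inj₁ r)
    ... | inj₂ r = inj₂ (inj₂ r)
    stays j (inj₂ (inj₁ e)) with forced e tl-tr (flip bl-tl) (λ ())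
    ... | inj₁ r = inj₂ (inj₂ r)
    ... | inj₂ r = inj₁ (inj₁ r)
    stays j (inj₂ (inj₂ e)) with forced e (flip tl-tr) (flip br-tr) (λ ())
    ... | inj₁ r = inj₂ (inj₁ r)
    ... | inj₂ r = inj₁ (inj₂ r)

    corner : ∃ λ j → InSquare (pt j)
    corner with bl-br
    ... | i , inj₁ (e , _) = i , inj₁ (inj₁ e)
    ... | i , inj₂ (e , _) = i , inj₁ (inj₂ e)

    columns : ∀ {c} → InSquare c → proj₁ c ≡ x ⊎ proj₁ c ≡ suc x
    columns (inj₁ (inj₁ refl)) = inj₁ refl
    columns (inj₁ (inj₂ refl)) = inj₂ refl
    columns (inj₂ (inj₁ refl)) = inj₁ refl
    columns (inj₂ (inj₂ refl)) = inj₂ refl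

    other : ∀ x → ∃ λ z → z < m × z ≢ x × z ≢ suc x
    other zero    = 2 , 2<m , (λ ()) , λ ()
    other (suc x) = 0 , <-trans (s≤s z≤n) 2<m , (λ ()) , λ ()

    outside : (∃ λ z → z < m × z ≢ x × z ≢ suc x) → ⊥
    outside (z , z<m , z≢x , z≢1+x) with index z 0 z<m 0<n
    ... | j , e with columns (closed⇒all stays (proj₁ corner) (proj₂ corner) j)
    ...   | inj₁ r = z≢x (trans (sym (cong proj₁ e)) r)
    ...   | inj₂ r = z≢1+x (trans (sym (cong proj₁ e)) r)

  edges : Edges m n H V
  edges = record
    { left = λ _ → refl ; right = right m refl ; bottom = λ _ → refl ; top = λ x → top x n refl
    ; H≤1 = λ { zero y → z≤n ; (suc x) y → indicator-≤1 (joined? _ _) }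
    ; degree = λ x y p q → let j , e = index x y p q in
        subst (λ c → let x = proj₁ c; y = proj₂ c in H x y + H (suc x) y + (V x y + V x (suc y)) ≡ 2) e (At.degree-at j)
    ; noSquare = λ x y _ _ → noSquare x y }
    where
    inside : ∀ {p c} → Joined p c → proj₁ c < m × proj₂ c < n
    inside (i , inj₁ (_ , refl)) = toℕ<n _ , toℕ<n _
    inside (i , inj₂ (refl , _)) = toℕ<n _ , toℕ<n _
    right : ∀ k → k ≡ m → ∀ y → H k y ≡ 0
    right zero    e y = refl
    right (suc k) e y = indicator-no (joined? _ _) (λ r → <-irrefl e (proj₁ (inside r)))
    top : ∀ x k → k ≡ n → V x k ≡ 0
    top x zero    e = refl
    top x (suc k) e = indicator-no (joined? _ _) (λ r → <-irrefl e (proj₂ (inside r)))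

  -- This lets a sum in the order of the cycle be rearranged into a sum by columns.
  cells-↭ : map (cell C) (allFin N) ↭ cartesianProduct (allFin m) (allFin n)
  cells-↭ = ∼bag⇒↭ (unique∧set⇒bag (unique-map⁺ (inj C) (allFin⁺ N)) (cartesianProduct⁺ (allFin⁺ m) (allFin⁺ n))
    (λ {c} → mk⇔ (λ _ → ∈-cartesianProduct⁺ (∈-allFin _) (∈-allFin _))
                 (λ _ → let j , e = surj C c in subst (_∈ map (cell C) (allFin N)) (e refl) (∈-map⁺ (cell C) (∈-allFin j)))))

  turns+straights : turns C + prefix (straightsIn n H) m ≡ m * n
  turns+straights = trans (cong (turns C +_) (sym total)) (count-exact (isTurn? C) (g ∘ cell C) N id At.turn-or-straight)
    where
    open ≡-Reasoning
    g : Cell m n → ℕ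
    g (x , y) = straight H (toℕ x) (toℕ y)
    total : sum (map (g ∘ cell C) (allFin N)) ≡ prefix (straightsIn n H) m
    total = begin
      sum (map (g ∘ cell C) (allFin N))                      ≡⟨ cong sum (map-∘ (allFin N)) ⟩
      sum (map g (map (cell C) (allFin N)))                  ≡⟨ sum-↭ (↭-map⁺ g cells-↭) ⟩
      sum (map g (cartesianProduct (allFin m) (allFin n)))   ≡⟨ sum-cartesian g (allFin m) (allFin n) ⟩
      sum (map (λ x → sum (map (λ y → g (x , y)) (allFin n))) (allFin m))
        ≡⟨ cong sum (map-cong (λ x → sum-allFin n (straight H (toℕ x))) (allFin m)) ⟩
      sum (map (straightsIn n H ∘ toℕ) (allFin m))           ≡⟨ sum-allFin m (straightsIn n H) ⟩
      Σ< m (straightsIn n H)                                 ≡⟨ Σ<-prefix m (straightsIn n H) ⟩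
      prefix (straightsIn n H) m ∎

-- The maximum number of turns

any-vec : ∀ {K} N {P : Vec.Vec (Fin K) N → Set} → (∀ v → Dec (P v)) → Dec (∃ P)
any-vec zero    P? = map′ (Vec.[] ,_) (λ { (Vec.[] , p) → p }) (P? Vec.[])
any-vec (suc N) P? =
  map′ (λ (i , v , p) → i Vec.∷ v , p) (λ { (i Vec.∷ v , p) → i , v , p }) (any? λ i → any-vec N λ v → P? (i Vec.∷ v))

-- A cycle decoded from its code agrees with the original only pointwise.
turns-cong : ∀ {m n} (C D : HamCycle m n) → (∀ i → cell C i ≡ cell D i) → turns C ≡ turns D
turns-cong {m} {n} C D e = cong length (filter-≐ (isTurn? C) (isTurn? D) (transport C D e , transport D C (sym ∘ e)) (allFin (m * n)))
  where
  transport : ∀ (C D : HamCycle m n) → (∀ i → cell C i ≡ cell D i) → ∀ {i} → IsTurn C i → IsTurn D i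
  transport C D e {i} t rewrite e (prevF i) | e i | e (nextF i) = t

module _ {m n : ℕ} where

  Tour : (Fin (m * n) → Cell m n) → Set
  Tour f = (∀ a b → ∃ λ i → f i ≡ (a , b)) × (∀ i → Adjacent (f i) (f (nextF i)))

  tour? : ∀ f → Dec (Tour f)
  tour? f = allFin? (λ a → allFin? λ b → any? λ i → ×-≡-dec _≟ᶠ_ _≟ᶠ_ (f i) (a , b)) ×-dec allFin? (λ i → _ ≟ 1)

  fromTour : ∀ f → Tour f → HamCycle m n
  fromTour f (s , a) = record
    { cell = f
    ; inj  = section⇒injective f (λ (x , y) → proj₁ (s x y)) (λ (x , y) → proj₂ (s x y))
    ; surj = λ (x , y) → proj₁ (s x y) , λ { refl → proj₂ (s x y) }
    ; adj  = a }

  fromCode : Vec.Vec (Fin (m * n)) (m * n) → Fin (m * n) → Cell m n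
  fromCode v i = remQuot n (Vec.lookup v i)

  -- A cycle is coded by a vector of cell numbers, and there are finitely many of these. The search
  -- decides the alternative for n ≡ 2 (mod 4).
  attains? : ∀ k → Dec (Σ (HamCycle m n) λ C → turns C ≡ k)
  attains? k = map′ (λ (v , t , e) → fromTour (fromCode v) t , e) (λ (C , e) → encode C e) (any-vec (m * n) coded?)
    where
    Coded : Vec.Vec (Fin (m * n)) (m * n) → Set
    Coded v = Σ (Tour (fromCode v)) λ t → turns (fromTour (fromCode v) t) ≡ k

    coded? : ∀ v → Dec (Coded v)
    coded? v with tour? (fromCode v)
    ... | no ¬t = no λ (t , _) → ¬t t
    ... | yes t with turns (fromTour (fromCode v) t) ≟ k
    ...   | yes e = yes (t , e)
    ...   | no ¬e = no λ (_ , e) → ¬e e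

    encode : (C : HamCycle m n) → turns C ≡ k → ∃ Coded
    encode C e = v , t , trans (turns-cong (fromTour (fromCode v) t) C same-cell) e
      where
      v = Vec.tabulate λ i → combine (proj₁ (cell C i)) (proj₂ (cell C i))
      same-cell : ∀ i → fromCode v i ≡ cell C i
      same-cell i = trans (cong (remQuot n) (lookup∘tabulate _ i)) (remQuot-combine (proj₁ (cell C i)) (proj₂ (cell C i)))
      t : Tour (fromCode v)
      t = (λ a b → let j , p = surj C (a , b) in j , trans (same-cell j) (p refl))
        , λ i → subst₂ Adjacent (sym (same-cell i)) (sym (same-cell (nextF i))) (adj C i)

-- Cycles and bounds for each residue of n modulo 4

HasCycle : ℕ → ℕ → ℕ → Set
HasCycle m n s = Σ (HamCycle m n) λ C → m * n ≤ turns C + s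

fromClosed : ∀ {m n s} → Closed (Rect m n) (m * n) s → HasCycle m n s
fromClosed P = hamCycle P , many-turns P

fromTransposed : ∀ {m n s} → Closed (Rect m n) (m * n) s → HasCycle n m s
fromTransposed {m} {n} P = fromClosed (relabelᶜ id id (*-comm m n) refl (mapClosed (transpose-onto m n) P))

rings : ∀ k {m n s} → Narrow (suc m) (4 + n) s →
        Closed (Rect (k * 4 + (2 + m)) (k * 4 + (4 + n))) ((k * 4 + (2 + m)) * (k * 4 + (4 + n))) (k * 4 + (2 + s))
rings zero    P = close-narrow P
-- `spiral` exchanges the two sides; the transposition restores their order.
rings (suc k) {m} {n} {s} P = subst₂ (λ M N → Closed (Rect M N) (M * N) (4 + (k * 4 + (2 + s)))) (eqM (k * 4) m) (eqN (k * 4) n)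
  (relabelᶜ id id (*-comm (5 + (k * 4 + (3 + n))) (6 + (k * 4 + m))) refl (mapClosed (transpose-onto _ _) (spiral k P)))
  where
  eqM : ∀ k m → 6 + (k + m) ≡ 4 + (k + (2 + m))
  eqM = solve-∀
  eqN : ∀ k n → 5 + (k + (3 + n)) ≡ 4 + (k + (4 + n))
  eqN = solve-∀

module Upper {m n} (C : HamCycle m n) (2<m : 2 < m) (0<n : 0 < n) where
  open Config C 2<m 0<n
  S : ℕ
  S = prefix (straightsIn n H) m

  total : turns C + S ≡ m * n
  total = turns+straights

  odd-bound : ¬ (2 ∣ n) → m ≤ S
  odd-bound o = odd-rows-bound edges o m ≤-refl

  even-bound : ∀ q → n ≡ q * 2 → n ≤ m → n ≤ S
  even-bound q e n≤m = subst (_≤ S) (sym n≡) (rows-bound (profile edges q e) (subst (_≤ m) n≡ n≤m))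
    where
    n≡ = trans e (trans (*-comm q 2) (cong (q +_) (+-identityʳ q)))

  S-even : ∀ q → n ≡ q * 2 → 2 ∣ S
  S-even q e = go m ≤-refl
    where
    go : ∀ i → i ≤ m → 2 ∣ prefix (straightsIn n H) i
    go zero    _ = 2 ∣0
    go (suc i) p = ∣m∣n⇒∣m+n (go i (<⇒≤ p)) (Profile.evenS (profile edges q e) i p)

  -- With S = 2t the bound 2m + n ≤ 3S + 2 gives 2m + n + 2 ≤ 6t + 4 < 6 (t + 1), so the quotient is
  -- at most t.
  third-bound : ∀ q → n ≡ q * 2 → ¬ (2 ∣ q) → n ≤ m → 2 * ((2 * m + n + 2) / 6) ≤ S
  third-bound q e o n≤m with S-even q e
  ... | divides t S≡ = subst (2 * ((2 * m + n + 2) / 6) ≤_) (sym (trans S≡ (*-comm t 2)))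
    (*-monoʳ-≤ 2 (≤-pred (m<n*o⇒m/o<n {2 * m + n + 2} {suc t} {6} (linear 1 (columns-bound o (profile edges q e) (subst (_≤ m) n≡ n≤m))
      (trans (cong (λ s → suc t * 6 + (m + m + s)) (sym n≡)) (trans (eq t m n) (cong (λ s → suc (2 * m + n + 2) + (s + s + s + 2) + 1) (sym S≡))))))))
    where
    n≡ = trans e (trans (*-comm q 2) (cong (q +_) (+-identityʳ q)))
    eq : ∀ t m n → suc t * 6 + (m + m + n) ≡ suc (2 * m + n + 2) + (t * 2 + t * 2 + t * 2 + 2) + 1
    eq = solve-∀

attained : ∀ {m n s} → HasCycle m n s → (∀ (C : HamCycle m n) → turns C + s ≤ m * n) → IsMaxTurns m n (m * n ∸ s)
attained {m} {n} {s} (C , p) u = (C , ≤-antisym (below C) (m≤n+o⇒m∸n≤o (m * n) s (subst (m * n ≤_) (+-comm (turns C) s) p))) , below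
  where
  below : ∀ C → turns C ≤ m * n ∸ s
  below C = m+n≤o⇒m≤o∸n (turns C) (u C)

odd-number : ∀ k → ¬ (2 ∣ suc (k * 2))
odd-number k d with ∣⇒≤ (∣m+n∣m⇒∣n (subst (2 ∣_) (+-comm 1 (k * 2)) d) (n∣m*n k))
... | s≤s ()

residue : ∀ {r} n → n % 4 ≡ r → ∃ λ j → n ≡ j * 4 + r
residue n e = n / 4 , trans (m≡m%n+[m/n]*n n 4) (trans (cong (_+ n / 4 * 4) e) (+-comm _ (n / 4 * 4)))

exceeds : ∀ {n m} → n < m → ∃ λ r → m ≡ n + suc r
exceeds {n} {m} p = m ∸ suc n , sym (trans (+-suc n _) (m+[n∸m]≡n p))

-- Rings preserve m - n, so its parity selects the innermost rectangle.
cycle₀ : ∀ j r → HasCycle (j * 4 + 4 + suc r) (j * 4 + 4) (j * 4 + 4)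
cycle₀ j r with parity r
... | evenly i = subst (λ m → HasCycle m (j * 4 + 4) (j * 4 + 4)) (eq (j * 4) (i * 2)) (fromClosed (rings j (four-odd i)))
  where
  eq : ∀ j i → j + (2 + (i + 3)) ≡ j + 4 + suc i
  eq = solve-∀
... | oddly i = subst (λ m → HasCycle m (j * 4 + 4) (j * 4 + 4)) (eq (j * 4) (i * 2)) (fromClosed (rings j (four-even (2 + i))))
  where
  eq : ∀ j i → j + (2 + (4 + i + 0)) ≡ j + 4 + suc (suc i)
  eq = solve-∀

even-gap : ∀ {m} n → (∃ λ r → m ≡ n + suc r) → 2 ∣ m → ¬ (2 ∣ n) → ∃ λ i → m ≡ n + suc (i * 2)
even-gap n (r , refl) 2∣m 2∤n with parity r
... | evenly i = i , refl
... | oddly i  = ⊥-elim (2∤n (∣m+n∣n⇒∣m 2∣m (n∣m*n (suc i))))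

odd-3 : ∀ j → ¬ (2 ∣ j * 4 + 3)
odd-3 j d = odd-number (j * 2 + 1) (subst (2 ∣_) (eq j) d)
  where
  eq : ∀ j → j * 4 + 3 ≡ suc ((j * 2 + 1) * 2)
  eq = solve-∀

odd-1 : ∀ j → ¬ (2 ∣ j * 4 + 1)
odd-1 j d = odd-number (j * 2) (subst (2 ∣_) (eq j) d)
  where
  eq : ∀ j → j * 4 + 1 ≡ suc (j * 2 * 2)
  eq = solve-∀

-- The innermost cycle has as many straight cells as its longer side has cells, and each ring raises
-- both numbers by four.
cycle₃ : ∀ j i → let m = j * 4 + 3 + suc (i * 2) in HasCycle m (j * 4 + 3) m
cycle₃ j i = subst (λ m → HasCycle m (j * 4 + 3) m) (eq (j * 4) (i * 2)) (fromTransposed (rings j (three i)))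
  where
  eq : ∀ j i → j + (4 + i) ≡ j + 3 + suc i
  eq = solve-∀

-- The paths `five` begin with difference m - n = 3. Difference 1 comes from a separate cycle for n
-- = 5 and from rings around `nine` for larger n.
cycle₁ : ∀ j i → let m = suc j * 4 + 1 + suc (i * 2) in HasCycle m (suc j * 4 + 1) m
cycle₁ zero    zero    = fromClosed six-by-five
cycle₁ (suc j) zero    = subst₂ (λ m n → HasCycle m n m) (eqM (j * 4)) (eqN (j * 4)) (fromTransposed (rings j nine))
  where
  eqM : ∀ j → j + 10 ≡ 8 + j + 1 + 1
  eqM = solve-∀
  eqN : ∀ j → j + 9 ≡ 8 + j + 1
  eqN = solve-∀
cycle₁ j (suc i) = subst₂ (λ m n → HasCycle m n m) (eqM (j * 4) (i * 2)) (eqN (j * 4)) (fromTransposed (rings j (five i)))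
  where
  eqM : ∀ j i → j + (8 + i) ≡ 4 + j + 1 + suc (2 + i)
  eqM = solve-∀
  eqN : ∀ j → j + 5 ≡ 4 + j + 1
  eqN = solve-∀

g : ℕ → ℕ → ℕ
g m n = 2 * ((2 * m + n + 2) / 6)

-- A ring and a block of six columns both raise 2m + n by 12 and so g by 4, in step with the four
-- straight cells that each costs.
g-shift : ∀ a {m n i} → 2 * m + n + 2 ≡ a * 6 + i → g m n ≡ a * 2 + 2 * (i / 6)
g-shift a {m} {n} {i} e = trans (cong (λ z → 2 * (z / 6)) e)
  (trans (cong (2 *_) (trans (+-distrib-/-∣ˡ i (n∣m*n a)) (cong (_+ i / 6) (m*n/n≡m a 6)))) (eq a (i / 6)))
  where
  eq : ∀ a b → 2 * (a + b) ≡ a * 2 + 2 * b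
  eq = solve-∀

-- For m = 7 + i and n = 6, the number 22 + 2i is 2m + n + 2.
six-base : ∀ t i → i < 6 → Narrow (6 + (t * 6 + i)) 6 (t * 4 + 2 * ((22 + 2 * i) / 6))
six-base t 0 _ = subst (λ m → Narrow m 6 (t * 4 + 6)) (eq (t * 6)) (widen t six-seven)
  where
  eq : ∀ t → t + 6 ≡ 6 + (t + 0)
  eq = solve-∀
six-base t 1 _ = subst (λ m → Narrow m 6 (t * 4 + 8)) (eq (t * 6)) (widen t six-eight)
  where
  eq : ∀ t → t + 7 ≡ 6 + (t + 1)
  eq = solve-∀
six-base t 2 _ = subst (Narrow (6 + (t * 6 + 2)) 6) (eq (t * 4)) (widen (suc t) six-three)
  where
  eq : ∀ t → 4 + (t + 4) ≡ t + 8
  eq = solve-∀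
six-base t 3 _ = subst (λ m → Narrow m 6 (t * 4 + 8)) (eq (t * 6)) (widen t six-ten)
  where
  eq : ∀ t → t + 9 ≡ 6 + (t + 3)
  eq = solve-∀
six-base t 4 _ = subst (Narrow (6 + (t * 6 + 4)) 6) (eq (t * 4)) (widen (suc t) six-five)
  where
  eq : ∀ t → 4 + (t + 6) ≡ t + 10
  eq = solve-∀
six-base t 5 _ = subst (Narrow (6 + (t * 6 + 5)) 6) (eq (t * 4)) (widen (suc t) six-six)
  where
  eq : ∀ t → 4 + (t + 6) ≡ t + 10
  eq = solve-∀
six-base t (suc (suc (suc (suc (suc (suc i)))))) (s≤s (s≤s (s≤s (s≤s (s≤s (s≤s ()))))))

cycle₂ : ∀ j r → let m = suc j * 4 + 2 + suc r; n = suc j * 4 + 2 in HasCycle m n (2 + g m n)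
cycle₂ j r = subst (λ r → HasCycle (suc j * 4 + 2 + suc r) (suc j * 4 + 2) (2 + g (suc j * 4 + 2 + suc r) (suc j * 4 + 2)))
  (sym (trans (m≡m%n+[m/n]*n r 6) (+-comm (r % 6) (r / 6 * 6))))
  (subst (HasCycle (suc j * 4 + 2 + suc (t * 6 + i)) (suc j * 4 + 2)) s≡
    (subst₂ (λ m n → HasCycle m n (j * 4 + (2 + (t * 4 + x)))) (eqM (j * 4) (t * 6) i) (eqN (j * 4))
      (fromClosed (rings j (six-base t i (m%n<n r 6))))))
  where
  t = r / 6
  i = r % 6
  x = 2 * ((22 + 2 * i) / 6)
  eqM : ∀ j t i → j + (7 + (t + i)) ≡ 4 + j + 2 + suc (t + i)
  eqM = solve-∀
  eqN : ∀ j → j + 6 ≡ 4 + j + 2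
  eqN = solve-∀
  s≡ : j * 4 + (2 + (t * 4 + x)) ≡ 2 + g (suc j * 4 + 2 + suc (t * 6 + i)) (suc j * 4 + 2)
  s≡ = trans (eq j t x) (cong (2 +_) (sym (g-shift (j * 2 + t * 2) {suc j * 4 + 2 + suc (t * 6 + i)} {suc j * 4 + 2} (num j t i))))
    where
    eq : ∀ j t x → j * 4 + (2 + (t * 4 + x)) ≡ 2 + ((j * 2 + t * 2) * 2 + x)
    eq = solve-∀
    num : ∀ j t i → 2 * (suc j * 4 + 2 + suc (t * 6 + i)) + (suc j * 4 + 2) + 2 ≡ (j * 2 + t * 2) * 6 + (22 + 2 * i)
    num = solve-∀

exists₀ : ∀ {m n} j → n ≡ j * 4 + 4 → n < m → HasCycle m n n
exists₀ j refl p with exceeds p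
... | r , refl = cycle₀ j r

max-turns₀ : ∀ m n → n < m → 2 < n → n % 4 ≡ 0 → IsMaxTurns m n (m * n ∸ n)
max-turns₀ m n n<m 2<n e with residue n e
... | zero  , refl with () ← 2<n
... | suc j , n≡ = attained (exists₀ j n≡′ n<m) λ C → let open Upper C (<-trans 2<n n<m) (<-trans (s≤s z≤n) 2<n) in
    ≤-trans (+-monoʳ-≤ (turns C) (even-bound (suc j * 2) (trans n≡ (eq j)) (<⇒≤ n<m))) (≤-reflexive total)
  where
  eq : ∀ j → suc j * 4 + 0 ≡ suc j * 2 * 2
  eq = solve-∀
  n≡′ : n ≡ j * 4 + 4
  n≡′ = trans n≡ (eq′ (j * 4))
    where
    eq′ : ∀ j → 4 + j + 0 ≡ j + 4
    eq′ = solve-∀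

max-turns-odd : ∀ m n → n < m → 2 < n → ¬ (2 ∣ n) → HasCycle m n m → IsMaxTurns m n (m * n ∸ m)
max-turns-odd m n n<m 2<n 2∤n c = attained c λ C → let open Upper C (<-trans 2<n n<m) (<-trans (s≤s z≤n) 2<n) in
    ≤-trans (+-monoʳ-≤ (turns C) (odd-bound 2∤n)) (≤-reflexive total)

even-columns : ∀ {m n} → 2 ∣ m * n → ¬ (2 ∣ n) → 2 ∣ m
even-columns {m} {n} d o with euclidsLemma m n prime[2] d
... | inj₁ p = p
... | inj₂ p = ⊥-elim (o p)

exists₁ : ∀ {m n} j i → n ≡ suc j * 4 + 1 → m ≡ n + suc (i * 2) → HasCycle m n m
exists₁ j i refl refl = cycle₁ j i

exists₃ : ∀ {m n} j i → n ≡ j * 4 + 3 → m ≡ n + suc (i * 2) → HasCycle m n m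
exists₃ j i refl refl = cycle₃ j i

max-turns₁ : ∀ m n → n < m → 2 < n → 2 ∣ m * n → n % 4 ≡ 1 → IsMaxTurns m n (m * n ∸ m)
max-turns₁ m n n<m 2<n 2∣mn e with residue n e
... | zero  , refl with s≤s () ← 2<n
... | suc j , n≡ = max-turns-odd m n n<m 2<n 2∤n (exists₁ j (proj₁ gap) n≡ (proj₂ gap))
  where
  2∤n = subst (λ n → ¬ (2 ∣ n)) (sym n≡) (odd-1 (suc j))
  gap = even-gap n (exceeds n<m) (even-columns {m} 2∣mn 2∤n) 2∤n

max-turns₃ : ∀ m n → n < m → 2 < n → 2 ∣ m * n → n % 4 ≡ 3 → IsMaxTurns m n (m * n ∸ m)
max-turns₃ m n n<m 2<n 2∣mn e with residue n e
... | j , n≡ = max-turns-odd m n n<m 2<n 2∤n (exists₃ j (proj₁ gap) n≡ (proj₂ gap))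
  where
  2∤n = subst (λ n → ¬ (2 ∣ n)) (sym n≡) (odd-3 j)
  gap = even-gap n (exceeds n<m) (even-columns {m} 2∣mn 2∤n) 2∤n

exists₂ : ∀ {m n} j → n ≡ suc j * 4 + 2 → n < m → HasCycle m n (2 + g m n)
exists₂ j refl p with exceeds p
... | r , refl = cycle₂ j r

-- S and g are even, so if no cycle has S = g, then all have S ≥ g + 2, which the construction
-- attains.
max-turns₂ : ∀ m n → n < m → 2 < n → n % 4 ≡ 2 → IsMaxTurns m n (m * n ∸ g m n) ⊎ IsMaxTurns m n (m * n ∸ g m n ∸ 2)
max-turns₂ m n n<m 2<n e with residue n e
... | zero  , refl with s≤s (s≤s ()) ← 2<n
... | suc j , n≡ = decide (attains? (m * n ∸ g m n))
  where
  q = suc (suc j * 2)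
  n≡2q : n ≡ q * 2
  n≡2q = trans n≡ (eq j)
    where
    eq : ∀ j → suc j * 4 + 2 ≡ suc (suc j * 2) * 2
    eq = solve-∀
  module U (C : HamCycle m n) = Upper C (<-trans 2<n n<m) (<-trans (s≤s z≤n) 2<n)

  enough : ∀ C → g m n ≤ U.S C
  enough C = U.third-bound C q n≡2q (odd-number (suc j)) (<⇒≤ n<m)

  bound : ∀ C → turns C + g m n ≤ m * n
  bound C = ≤-trans (+-monoʳ-≤ (turns C) (enough C)) (≤-reflexive (U.total C))

  exact : ∀ C → U.S C ≡ g m n → turns C ≡ m * n ∸ g m n
  exact C s = trans (sym (m+n∸n≡m (turns C) (g m n))) (cong (_∸ g m n) (trans (cong (turns C +_) (sym s)) (U.total C)))

  two-more : ∀ {a b} → 2 ∣ a → 2 ∣ b → a ≤ b → b ≢ a → 2 + a ≤ b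
  two-more {a} {b} p r a≤b ne = subst (2 + a ≤_) (m∸n+n≡m a≤b) (+-monoˡ-≤ a
    (even-positive (∣m+n∣m⇒∣n (subst (2 ∣_) (sym (m+[n∸m]≡n a≤b)) r) p) (λ z → ne (≤-antisym (m∸n≡0⇒m≤n z) a≤b))))

  decide : Dec (Σ (HamCycle m n) λ C → turns C ≡ m * n ∸ g m n) →
           IsMaxTurns m n (m * n ∸ g m n) ⊎ IsMaxTurns m n (m * n ∸ g m n ∸ 2)
  decide (yes C) = inj₁ (C , λ D → m+n≤o⇒m≤o∸n (turns D) (bound D))
  decide (no ¬C) = inj₂ (subst (IsMaxTurns m n) (trans (cong (m * n ∸_) (+-comm 2 (g m n))) (sym (∸-+-assoc (m * n) (g m n) 2)))
    (attained (exists₂ j n≡ n<m) λ C → ≤-trans (+-monoʳ-≤ (turns C)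
      (two-more (m∣m*n ((2 * m + n + 2) / 6)) (U.S-even C q n≡2q) (enough C) (λ s → ¬C (C , exact C s)))) (≤-reflexive (U.total C))))

theorem2 : ∀ (m n : ℕ) → n < m → 2 < n → 2 ∣ m * n →
    (n % 4 ≡ 0 → IsMaxTurns m n (m * n ∸ n))
    × ((n % 4 ≡ 1 ⊎ n % 4 ≡ 3) → IsMaxTurns m n (m * n ∸ m))
    × (n % 4 ≡ 2 →
    IsMaxTurns m n (m * n ∸ 2 * ((2 * m + n + 2) / 6))
    ⊎ IsMaxTurns m n (m * n ∸ 2 * ((2 * m + n + 2) / 6) ∸ 2))
theorem2 m n n<m 2<n 2∣mn = max-turns₀ m n n<m 2<n , odd-case , max-turns₂ m n n<m 2<n
  where
  odd-case : n % 4 ≡ 1 ⊎ n % 4 ≡ 3 → IsMaxTurns m n (m * n ∸ m)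
  odd-case (inj₁ e) = max-turns₁ m n n<m 2<n 2∣mn e
  odd-case (inj₂ e) = max-turns₃ m n n<m 2<n 2∣mn e
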